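{- (i) $E_1(x)=-\tfrac12(1-2x-x^2)+\tfrac{1-3x}{4}(1-4x)^{ -1/2}+\tfrac{1-3x-4x^2+4x^3}{4}(1-4x^2)^{ -1/2}$. (ii) $O_1(x)=-\tfrac12(x+x^2)+\tfrac{1-3x}{4}(1-4x)^{ -1/2}-\tfrac{1-3x-4x^2+4x^3}{4}(1-4x^2)^{ -1/2}$. (iii) $F_1(x)=\tfrac12(x-1)+\tfrac{1-3x}{2}(1-4x)^{ -1/2}$.
   Context: An occurrence of $132$ in $\pi=\pi_1\cdots\pi_n\in\mathfrak S_n$ is a triple $i<j<k$ with $\pi_i<\pi_k<\pi_j$. A permutation is even or odd according to the parity of its number of inversions. $E_1(x)$ is $\sum_{n\ge0}$ (number of even $\pi\in\mathfrak S_n$ with exactly one occurrence of $132$) $x^n$. $O_1(x)$ is the same with odd permutations. $F_1(x)=E_1(x)+O_1(x)$ is the generating function of all permutations with exactly one occurrence of $132$. -}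

module Defs where

open import Data.Bool using (Bool; true; false; _∧_; not)
open import Data.Nat as ℕ using (ℕ; zero; suc; _∸_)
open import Data.Nat.Properties using (_<?_; _≟_)
open import Data.Integer using (+_; -[1+_])
open import Data.Rational using (ℚ; 0ℚ; 1ℚ; _+_; _*_; -_; _/_)
open import Data.List using (List; []; _∷_; [_]; length; filter; map; concatMap; upTo; foldr)
open import Data.List.Membership.DecPropositional (_≟_) using (_∈?_)
open import Data.Product using (_×_)
open import Relation.Nullary.Decidable using (_×-dec_; ⌊_⌋)
open import Relation.Binary.PropositionalEquality using (_≡_)

-- Permutations of {0,…,n-1} in one-line notation, as lists of naturals.

words : ℕ → ℕ → List (List ℕ)
words zero    n = [ [] ]
words (suc k) n = concatMap (λ a → map (a ∷_) (words k n)) (upTo n)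

distinct : List ℕ → Bool
distinct []      = true
distinct (a ∷ w) = not ⌊ a ∈? w ⌋ ∧ distinct w

perms : ℕ → List (List ℕ)
perms n = filter (λ w → distinct w ≟B true) (words n n)
  where
  open import Data.Bool.Properties renaming (_≟_ to _≟B_)

inv : List ℕ → ℕ
inv []      = 0
inv (a ∷ w) = length (filter (_<? a) w) ℕ.+ inv w

occ132From : ℕ → List ℕ → ℕ
occ132From a []      = 0
occ132From a (b ∷ w) = length (filter (λ c → (a <? c) ×-dec (c <? b)) w) ℕ.+ occ132From a w

occ132 : List ℕ → ℕ
occ132 []      = 0
occ132 (a ∷ w) = occ132From a w ℕ.+ occ132 w

isEven : ℕ → Bool
isEven zero          = true
isEven (suc zero)    = false
isEven (suc (suc n)) = isEven n

e1 : ℕ → ℕ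
e1 n = length (filter (λ π → ((occ132 π ≟ 1) ×-dec (isEven (inv π) ≟B true))) (perms n))
  where
  open import Data.Bool.Properties renaming (_≟_ to _≟B_)

o1 : ℕ → ℕ
o1 n = length (filter (λ π → ((occ132 π ≟ 1) ×-dec (isEven (inv π) ≟B false))) (perms n))
  where
  open import Data.Bool.Properties renaming (_≟_ to _≟B_)

f1 : ℕ → ℕ
f1 n = length (filter (λ π → occ132 π ≟ 1) (perms n))

Series : Set
Series = ℕ → ℚ

ofℕ : (ℕ → ℕ) → Series
ofℕ f n = + (f n) / 1

infixl 6 _⊕_ _⊖_
infixr 7 _·_
infixl 8 _⊛_

_⊕_ : Series → Series → Series
(f ⊕ g) n = f n + g n

_⊖_ : Series → Series → Series
(f ⊖ g) n = f n + - (g n)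

_·_ : ℚ → Series → Series
(c · f) n = c * f n

_⊛_ : Series → Series → Series
(f ⊛ g) n = foldr _+_ 0ℚ (map (λ k → f k * g (n ∸ k)) (upTo (suc n)))

poly : List ℚ → Series
poly []       n       = 0ℚ
poly (c ∷ cs) zero    = c
poly (c ∷ cs) (suc n) = poly cs n

one : Series
one = poly (1ℚ ∷ [])

q : ℕ → ℚ
q n = + n / 1

IsInvSqrt1-4x : Series → Set
IsInvSqrt1-4x S = (S 0 ≡ 1ℚ) × (∀ n → ((S ⊛ S) ⊛ poly (1ℚ ∷ - q 4 ∷ [])) n ≡ one n)

IsInvSqrt1-4x² : Series → Set
IsInvSqrt1-4x² T = (T 0 ≡ 1ℚ) × (∀ n → ((T ⊛ T) ⊛ poly (1ℚ ∷ 0ℚ ∷ - q 4 ∷ [])) n ≡ one n)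

{-# OPTIONS --safe #-}

-- Split a permutation at its maximum as u m v. Every pair a < c with a in u and c in v gives the
-- occurrence a m c, so with at most one occurrence there is at most one such pair. If there is none,
-- u lies above v and the occurrences are those of u and of v. If there is one, then a is the
-- last entry of u, a and c are consecutive values, exchanging them leads back to the first
-- situation, and nothing else may contain an occurrence. Weighting by the sign (or by 1) turns this
-- into recurrences A = 1 + x⟨A,A⟩ and B = x(⟨B,A⟩ + ⟨A,B⟩) + x²(…) for avoiders and for single
-- occurrences. Unsigned, ⟨f,g⟩ is the product and 1 - 2xA is a square root of 1 - 4x. Signed, the
-- even part of A is 1, the odd part O satisfies O = x(1 + O²), and 1 - 2xO is a square root
-- of 1 - 4x². As S and T are inverse to these square roots, the closed forms follow linearly.

module Submission where

open import Defs
open import Data.List using (List; []; _∷_)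
open import Data.Product using (_×_)
open import Data.Rational using (ℚ; 0ℚ; 1ℚ; ½; -_; _/_)
open import Relation.Binary.PropositionalEquality using (_≡_)

-- Once both sides of the maximum are standardised, the inversions between them depend on the
-- lengths alone: `suc j * k` of them for `j` entries before and `k` entries after the maximum, if
-- nothing crosses. The obstacle is that the sign of this number is not a function of `j` times a
-- function of `k`, so the signed product is not a Cauchy product. The sign is 1 for odd `j` and
-- (-1)^k for even `j`; hence f(-x) and g(-x) enter beside f and g, and the signed count becomes a
-- system for two series and their reflections, solved by taking even and odd parts. In a crossed
-- piece with right part of length k the exchanged entry and the maximum contribute k - 1 and k
-- inversions, an odd sum, while each of the `i` entries of the left part contributes k + 1. So the
-- roles of the two sides are reversed and a minus sign appears. Pieces are built from arbitrary
-- permutations, although the bijection concerns only those with at most one occurrence: weights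
-- that vanish beyond one occurrence make the restriction disappear from both sums.

module Patterns where

  open import Data.Bool using (true)
  open import Data.Empty using (⊥-elim)
  open import Data.List using (map; filter; length; _++_; upTo; concatMap)
  open import Data.List.Membership.Propositional using (_∈_; _∉_; lose; find)
  open import Data.List.Membership.Propositional.Properties
    using (∈-∃++; ∈-++⁺ˡ; ∈-++⁺ʳ; ∈-++⁻; ∈-map⁺; ∈-map⁻; ∈-upTo⁺; ∈-upTo⁻;
           ∈-concatMap⁺; ∈-concatMap⁻; ∈-filter⁺; ∈-filter⁻)
  open import Data.List.Properties
    using (filter-++; filter-all; filter-none; filter-some; filter-accept; filter-reject;
           length-++; length-map; length-upTo; length-++-sucʳ;
           map-++; map-id-local; map-injective; ++-assoc; ∷-injective; ∷ʳ-injectiveˡ)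
  open import Data.List.Relation.Unary.All as All using (All; []; _∷_)
  import Data.List.Relation.Unary.All.Properties as Allₚ
  open import Data.List.Relation.Unary.AllPairs using ([]; _∷_)
  open import Data.List.Relation.Unary.Any using (here; there)
  open import Data.List.Relation.Unary.Unique.Propositional using (Unique)
  import Data.List.Relation.Unary.Unique.Propositional.Properties as Uniqueₚ
  open import Data.Nat using (ℕ; zero; suc; pred; _+_; _*_; _∸_; _≤_; _<_; z≤n; s≤s; s≤s⁻¹)
  open import Data.Nat.Properties
  open import Data.List.Membership.DecPropositional _≟_ using (_∈?_)
  open import Data.Nat.Solver using (module +-*-Solver)
  open import Data.Product using (_,_; proj₁; proj₂; ∃; ∃₂)
  open import Data.Sum using (_⊎_; inj₁; inj₂)
  open import Function using (_∘_)
  open import Relation.Binary.Definitions using (tri<; tri≈; tri>)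
  open import Relation.Binary.PropositionalEquality
    using (refl; sym; trans; cong; cong₂; subst; subst₂; _≢_)
  open import Relation.Nullary using (¬_; yes; no)
  open import Relation.Nullary.Decidable using (_×-dec_)
  open import Relation.Unary using (Pred; Decidable)
  open +-*-Solver using (solve; _:=_; _:+_; _:*_; con)

  private variable
    A : Set

  -- Counting in words; `inv` and `occ132` under relabelling and concatenation.

  module _ {p} {P : Pred ℕ p} (P? : Decidable P) where

    count-++ : ∀ u w → length (filter P? (u ++ w)) ≡ length (filter P? u) + length (filter P? w)
    count-++ u w = trans (cong length (filter-++ P? u w)) (length-++ (filter P? u))

    count-all : ∀ {w} → All P w → length (filter P? w) ≡ length w
    count-all = cong length ∘ filter-all P?

    count-none : ∀ {w} → All (¬_ ∘ P) w → length (filter P? w) ≡ 0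
    count-none = cong length ∘ filter-none P?

    count-member : ∀ {c w} → c ∈ w → P c → 1 ≤ length (filter P? w)
    count-member c∈w Pc = filter-some P? (lose c∈w Pc)

  count-map : ∀ {p q} {P : Pred ℕ p} {Q : Pred ℕ q} (P? : Decidable P) (Q? : Decidable Q) (g : ℕ → ℕ) →
              (∀ {x} → P (g x) → Q x) → (∀ {x} → Q x → P (g x)) →
              ∀ w → length (filter P? (map g w)) ≡ length (filter Q? w)
  count-map P? Q? g P⇒Q Q⇒P []      = refl
  count-map P? Q? g P⇒Q Q⇒P (x ∷ w) with P? (g x) | Q? x
  ... | yes _ | yes _ = cong suc (count-map P? Q? g P⇒Q Q⇒P w)
  ... | no _  | no _  = count-map P? Q? g P⇒Q Q⇒P w
  ... | yes p | no ¬q = ⊥-elim (¬q (P⇒Q p))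
  ... | no ¬p | yes q = ⊥-elim (¬p (Q⇒P q))

  between? : ∀ a b → Decidable (λ c → a < c × c < b)
  between? a b c = (a <? c) ×-dec (c <? b)

  StrictlyIncreasing : (ℕ → ℕ) → Set
  StrictlyIncreasing g = ∀ {x y} → x < y → g x < g y

  module _ {g : ℕ → ℕ} (mono : StrictlyIncreasing g) where

    increasing-reflects : ∀ {x y} → g x < g y → x < y
    increasing-reflects {x} {y} gx<gy with <-cmp x y
    ... | tri< x<y _ _ = x<y
    ... | tri≈ _ refl _ = ⊥-elim (<-irrefl refl gx<gy)
    ... | tri> _ _ y<x = ⊥-elim (<-asym gx<gy (mono y<x))

    increasing-injective : ∀ {x y} → g x ≡ g y → x ≡ y
    increasing-injective {x} {y} gx≡gy with <-cmp x y
    ... | tri< x<y _ _ = ⊥-elim (<⇒≢ (mono x<y) gx≡gy)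
    ... | tri≈ _ x≡y _ = x≡y
    ... | tri> _ _ y<x = ⊥-elim (<⇒≢ (mono y<x) (sym gx≡gy))

    inv-map : ∀ w → inv (map g w) ≡ inv w
    inv-map []      = refl
    inv-map (a ∷ w) = cong₂ _+_ (count-map (_<? g a) (_<? a) g increasing-reflects mono w) (inv-map w)

    occ132From-map : ∀ a w → occ132From (g a) (map g w) ≡ occ132From a w
    occ132From-map a []      = refl
    occ132From-map a (b ∷ w) = cong₂ _+_
      (count-map (between? (g a) (g b)) (between? a b) g
        (λ (p , r) → increasing-reflects p , increasing-reflects r) (λ (p , r) → mono p , mono r) w)
      (occ132From-map a w)

    occ132-map : ∀ w → occ132 (map g w) ≡ occ132 w
    occ132-map []      = refl
    occ132-map (a ∷ w) = cong₂ _+_ (occ132From-map a w) (occ132-map w)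

  -- The inversions between `u` and `w` are counted from the side of `u`. In both kinds of piece
  -- every entry of the left part sees the same number `c` of smaller entries further right, which
  -- is why only lengths will matter.
  inv-++ : ∀ c {u w} → All (λ a → length (filter (_<? a) w) ≡ c) u →
           inv (u ++ w) ≡ inv u + inv w + length u * c
  inv-++ c {[]}    {w} []       = sym (+-identityʳ (inv w))
  inv-++ c {a ∷ u} {w} (p ∷ ps) = trans
    (cong₂ _+_ (trans (count-++ (_<? a) u w) (cong (_+_ (length (filter (_<? a) u))) p)) (inv-++ c ps))
    (solve 5 (λ f c i j l → (f :+ c) :+ (i :+ j :+ l) := (f :+ i) :+ j :+ (c :+ l)) refl
      (length (filter (_<? a) u)) c (inv u) (inv w) (length u * c))

  occ132From-++ : ∀ a u w → (∀ {b c} → b ∈ u → c ∈ w → ¬ (a < c × c < b)) →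
                  occ132From a (u ++ w) ≡ occ132From a u + occ132From a w
  occ132From-++ a []      w convex = refl
  occ132From-++ a (b ∷ u) w convex = trans
    (cong₂ _+_ (trans (count-++ (between? a b) u w)
                 (trans (cong (_+_ f) (count-none (between? a b) (All.tabulate (convex (here refl))))) (+-identityʳ f)))
               (occ132From-++ a u w (convex ∘ there)))
    (sym (+-assoc f (occ132From a u) (occ132From a w)))
    where
    f : ℕ
    f = length (filter (between? a b) u)

  -- An occurrence that straddles the cut has either two entries in `u`, excluded by `convex`, or
  -- one, excluded by `from≡0`.
  occ132-++ : ∀ u w → (∀ {a b c} → a ∈ u → b ∈ u → c ∈ w → ¬ (a < c × c < b)) →
              (∀ {a} → a ∈ u → occ132From a w ≡ 0) → occ132 (u ++ w) ≡ occ132 u + occ132 w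
  occ132-++ []      w convex from≡0 = refl
  occ132-++ (a ∷ u) w convex from≡0 = trans
    (cong₂ _+_ (trans (occ132From-++ a u w (λ b∈u → convex (here refl) (there b∈u)))
                 (trans (cong (_+_ (occ132From a u)) (from≡0 (here refl))) (+-identityʳ _)))
               (occ132-++ u w (λ a∈u b∈u → convex (there a∈u) (there b∈u)) (from≡0 ∘ there)))
    (sym (+-assoc (occ132From a u) (occ132 u) (occ132 w)))

  occ132From-none : ∀ a w → (∀ {b c} → b ∈ w → c ∈ w → a < c → ¬ c < b) → occ132From a w ≡ 0
  occ132From-none a []      none = refl
  occ132From-none a (b ∷ w) none = cong₂ _+_
    (count-none (between? a b) {w} (All.tabulate (λ c∈w (a<c , c<b) → none (here refl) (there c∈w) a<c c<b)))
    (occ132From-none a w (λ b∈w c∈w → none (there b∈w) (there c∈w)))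

  occ132From-suffix : ∀ a u w → occ132From a w ≤ occ132From a (u ++ w)
  occ132From-suffix a []      w = ≤-refl
  occ132From-suffix a (b ∷ u) w = ≤-trans (occ132From-suffix a u w) (m≤n+m _ _)

  occ132-suffix : ∀ u w → occ132 w ≤ occ132 (u ++ w)
  occ132-suffix []      w = ≤-refl
  occ132-suffix (b ∷ u) w = ≤-trans (occ132-suffix u w) (m≤n+m _ _)

  occ132From-member : ∀ {a m c} u {w} → c ∈ w → a < c → c < m → 1 ≤ occ132From a (u ++ m ∷ w)
  occ132From-member {a} {m} u {w} c∈w a<c c<m =
    ≤-trans (≤-trans (count-member (between? a m) c∈w (a<c , c<m)) (m≤m+n _ _)) (occ132From-suffix a u (m ∷ w))

  -- Words without repetition, pigeonhole bounds and the list `perms n`.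

  Unique-++⁻ : ∀ (u : List A) {w} → Unique (u ++ w) → Unique u × Unique w × (∀ {x y} → x ∈ u → y ∈ w → x ≢ y)
  Unique-++⁻ []      w!            = [] , w! , λ ()
  Unique-++⁻ (a ∷ u) (a∉ ∷ uw!) with u! , w! , u#w ← Unique-++⁻ u uw! =
    Allₚ.++⁻ˡ u a∉ ∷ u! , w! ,
    λ { (here refl) y∈w → All.lookup (Allₚ.++⁻ʳ u a∉) y∈w ; (there x∈u) y∈w → u#w x∈u y∈w }

  Unique-∷⁻ : ∀ {a : A} {w} → Unique (a ∷ w) → ∀ {x} → x ∈ w → a ≢ x
  Unique-∷⁻ (a∉ ∷ _) = All.lookup a∉

  Unique-++⁺ : ∀ {u w : List A} → Unique u → Unique w → (∀ {x y} → x ∈ u → y ∈ w → x ≢ y) → Unique (u ++ w)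
  Unique-++⁺ u! w! u#w = Uniqueₚ.++⁺ u! w! (λ (x∈u , x∈w) → u#w x∈u x∈w refl)

  Unique-∷⁺ : ∀ {a : A} {w} → (∀ {x} → x ∈ w → a ≢ x) → Unique w → Unique (a ∷ w)
  Unique-∷⁺ a∉w w! = All.tabulate a∉w ∷ w!

  ⊆⇒length≤ : ∀ {u w : List A} → Unique u → (∀ {x} → x ∈ u → x ∈ w) → length u ≤ length w
  ⊆⇒length≤ {u = []}            u!         u⊆w = z≤n
  ⊆⇒length≤ {u = a ∷ u}         (a∉ ∷ u!) u⊆w with ∈-∃++ (u⊆w (here refl))
  ... | w₁ , w₂ , refl = subst (suc (length u) ≤_) (sym (length-++-sucʳ w₁ a w₂)) (s≤s (⊆⇒length≤ u! u⊆w₁w₂))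
    where
    u⊆w₁w₂ : ∀ {x} → x ∈ u → x ∈ w₁ ++ w₂
    u⊆w₁w₂ x∈u with ∈-++⁻ w₁ (u⊆w (there x∈u))
    ... | inj₁ x∈w₁         = ∈-++⁺ˡ x∈w₁
    ... | inj₂ (here refl)  = ⊥-elim (All.lookup a∉ x∈u refl)
    ... | inj₂ (there x∈w₂) = ∈-++⁺ʳ w₁ x∈w₂

  count-two : ∀ {p} {P : Pred A p} (P? : Decidable P) {x y w} → x ≢ y → x ∈ w → y ∈ w → P x → P y →
              2 ≤ length (filter P? w)
  count-two P? {x} {y} {w} x≢y x∈w y∈w Px Py = ⊆⇒length≤ {u = x ∷ y ∷ []} ((x≢y ∷ []) ∷ [] ∷ []) λ
    { (here refl)         → ∈-filter⁺ P? x∈w Px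
    ; (there (here refl)) → ∈-filter⁺ P? y∈w Py }

  pigeonhole : ∀ lo hi {w} → Unique w → (∀ {x} → x ∈ w → lo ≤ x × x < hi) → length w ≤ hi ∸ lo
  pigeonhole lo hi {w} w! bounds =
    subst (length w ≤_) (trans (length-map (lo +_) (upTo (hi ∸ lo))) (length-upTo (hi ∸ lo))) (⊆⇒length≤ w! into)
    where
    into : ∀ {x} → x ∈ w → x ∈ map (lo +_) (upTo (hi ∸ lo))
    into {x} x∈w with lo≤x , x<hi ← bounds x∈w =
      subst (_∈ map (lo +_) (upTo (hi ∸ lo))) (m+[n∸m]≡n lo≤x) (∈-map⁺ (lo +_) (∈-upTo⁺ (∸-monoˡ-< x<hi lo≤x)))

  -- Surjectivity is not a field: that the maximum occurs is recovered by pigeonhole in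
  -- `IsPerm-max`.
  record IsPerm (n : ℕ) (w : List ℕ) : Set where
    constructor isPerm
    field
      length≡ : length w ≡ n
      bounded : ∀ {x} → x ∈ w → x < n
      unique  : Unique w

  open IsPerm

  distinct⇒Unique : ∀ w → distinct w ≡ true → Unique w
  distinct⇒Unique []      _ = []
  distinct⇒Unique (a ∷ w) d with a ∈? w
  ... | no a∉w = All.tabulate (λ x∈w a≡x → a∉w (subst (_∈ w) (sym a≡x) x∈w)) ∷ distinct⇒Unique w d

  Unique⇒distinct : ∀ w → Unique w → distinct w ≡ true
  Unique⇒distinct []      _ = refl
  Unique⇒distinct (a ∷ w) (a∉ ∷ w!) with a ∈? w
  ... | no _    = Unique⇒distinct w w!
  ... | yes a∈w = ⊥-elim (All.lookup a∉ a∈w refl)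

  ∈-words⁻ : ∀ k n {w} → w ∈ words k n → length w ≡ k × (∀ {x} → x ∈ w → x < n)
  ∈-words⁻ zero    n (here refl) = refl , λ ()
  ∈-words⁻ (suc k) n w∈ with a , a∈ , w∈a ← find (∈-concatMap⁻ _ {xs = upTo n} w∈)
    with v , v∈ , refl ← ∈-map⁻ (a ∷_) w∈a
    with l , b ← ∈-words⁻ k n v∈ = cong suc l , λ { (here refl) → ∈-upTo⁻ a∈ ; (there x∈v) → b x∈v }

  ∈-words⁺ : ∀ k n {w} → length w ≡ k → (∀ {x} → x ∈ w → x < n) → w ∈ words k n
  ∈-words⁺ zero    n {[]}    l b = here refl
  ∈-words⁺ (suc k) n {a ∷ w} l b = ∈-concatMap⁺ _ (lose (∈-upTo⁺ (b (here refl)))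
    (∈-map⁺ (a ∷_) (∈-words⁺ k n (suc-injective l) (b ∘ there))))

  ∈-perms⁻ : ∀ {n w} → w ∈ perms n → IsPerm n w
  ∈-perms⁻ {n} {w} w∈ with w∈words , d ← ∈-filter⁻ _ {xs = words n n} w∈ with l , b ← ∈-words⁻ n n w∈words =
    isPerm l b (distinct⇒Unique w d)

  ∈-perms⁺ : ∀ {n w} → IsPerm n w → w ∈ perms n
  ∈-perms⁺ {n} {w} (isPerm l b u) = ∈-filter⁺ _ (∈-words⁺ n n l b) (Unique⇒distinct w u)

  -- `key` reads the index of its block off an element, so different blocks are disjoint. The key is
  -- the first letter for `words` and the length of the first component for pairs.
  concatMap-Unique : ∀ {B : Set} (key : B → A) (f : A → List B) → (∀ a → Unique (f a)) →
                     (∀ {a b} → b ∈ f a → key b ≡ a) → ∀ {xs} → Unique xs → Unique (concatMap f xs)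
  concatMap-Unique key f f! key-f {[]}     []         = []
  concatMap-Unique key f f! key-f {x ∷ xs} (x∉ ∷ xs!) =
    Unique-++⁺ (f! x) (concatMap-Unique key f f! key-f xs!) disjoint
    where
    disjoint : ∀ {b c} → b ∈ f x → c ∈ concatMap f xs → b ≢ c
    disjoint b∈ c∈ refl with a , a∈ , c∈a ← find (∈-concatMap⁻ f {xs = xs} c∈) =
      All.lookup x∉ a∈ (trans (sym (key-f b∈)) (key-f c∈a))

  words-Unique : ∀ k n → Unique (words k n)
  words-Unique zero    n = [] ∷ []
  words-Unique (suc k) n = concatMap-Unique head _ (λ a → Uniqueₚ.map⁺ (λ { refl → refl }) (words-Unique k n))
    (λ {a} b∈ → head-∷ a b∈) (Uniqueₚ.upTo⁺ n)
    where
    head : List ℕ → ℕ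
    head []      = 0
    head (a ∷ _) = a
    head-∷ : ∀ a {b} → b ∈ map (a ∷_) (words k n) → head b ≡ a
    head-∷ a b∈ with _ , _ , refl ← ∈-map⁻ (a ∷_) b∈ = refl

  perms-Unique : ∀ n → Unique (perms n)
  perms-Unique n = Uniqueₚ.filter⁺ _ (words-Unique n n)

  IsPerm-max : ∀ {n w} → IsPerm (suc n) w → ∃₂ λ u v → w ≡ u ++ n ∷ v
  IsPerm-max {n} {w} p with n ∈? w
  ... | yes n∈w = ∈-∃++ n∈w
  ... | no  n∉w = ⊥-elim (<-irrefl refl (subst (_≤ n) (length≡ p)
                    (pigeonhole 0 n (unique p) (λ x∈w → z≤n , ≤∧≢⇒< (s≤s⁻¹ (bounded p x∈w)) (λ x≡n → n∉w (subst (_∈ w) x≡n x∈w))))))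

  -- The increasing map whose image omits exactly `k`. In a crossed piece it frees one value below
  -- the maximum of the right part for the entry just before the overall maximum.
  skip : ℕ → ℕ → ℕ
  skip zero    x       = suc x
  skip (suc k) zero    = zero
  skip (suc k) (suc x) = suc (skip k x)

  skip-increasing : ∀ k → StrictlyIncreasing (skip k)
  skip-increasing zero    x<y                   = s≤s x<y
  skip-increasing (suc k) {zero}  {suc y} _     = s≤s z≤n
  skip-increasing (suc k) {suc x} {suc y} x<y   = s≤s (skip-increasing k (s≤s⁻¹ x<y))

  skip-< : ∀ {k x} → x < k → skip k x ≡ x
  skip-< {suc k} {zero}  _   = refl
  skip-< {suc k} {suc x} x<k = cong suc (skip-< (s≤s⁻¹ x<k))

  skip-≡ : ∀ k → skip k k ≡ suc k
  skip-≡ zero    = refl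
  skip-≡ (suc k) = cong suc (skip-≡ k)

  skip-≢ : ∀ k x → skip k x ≢ k
  skip-≢ (suc k) (suc x) eq = skip-≢ k x (suc-injective eq)

  skip-≤ : ∀ k {x} → x ≤ k → skip k x ≤ suc k
  skip-≤ zero    x≤k           = s≤s x≤k
  skip-≤ (suc k) {zero}  _     = z≤n
  skip-≤ (suc k) {suc x} x≤k   = s≤s (skip-≤ k (s≤s⁻¹ x≤k))

  -- Pieces: assembling a permutation around its maximum.

  Above : ℕ → List ℕ → List ℕ → Set
  Above m u w = ∀ {a c} → a ∈ u → c ∈ w → c ≡ m ⊎ c < a

  module _ {m u w} (u<m : ∀ {a} → a ∈ u → a < m) (w≤m : ∀ {c} → c ∈ w → c ≤ m) (above : Above m u w) where

    -- The last entry of a straddling occurrence exceeds the first one, so by `Above` it is `m`; but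
    -- `m` bounds all entries and leaves no room for a larger middle entry.
    occ132-above : occ132 (u ++ w) ≡ occ132 u + occ132 w
    occ132-above = occ132-++ u w convex λ a∈u → occ132From-none _ w (none a∈u)
      where
      convex : ∀ {a b c} → a ∈ u → b ∈ u → c ∈ w → ¬ (a < c × c < b)
      convex a∈u b∈u c∈w (a<c , c<b) with above a∈u c∈w
      ... | inj₁ refl = <-asym c<b (u<m b∈u)
      ... | inj₂ c<a  = <-asym c<a a<c
      none : ∀ {a b c} → a ∈ u → b ∈ w → c ∈ w → a < c → ¬ c < b
      none a∈u b∈w c∈w a<c c<b with above a∈u c∈w
      ... | inj₁ refl = <-irrefl refl (<-≤-trans c<b (w≤m b∈w))
      ... | inj₂ c<a  = <-asym c<a a<c

    Unique-above : (∀ {a} → a ∈ u → ¬ a ∈ w) → Unique u → Unique w → Unique (u ++ w)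
    Unique-above u#w u! w! = Unique-++⁺ u! w! (λ { x∈u y∈w refl → u#w x∈u y∈w })

  -- l and r stand for the entries before and after the maximum, standardised; in a crossed piece
  -- l omits the last entry before the maximum, whose value |r| - 1 is the only one exceeded
  -- by an entry after the maximum, namely by |r|.
  data Piece : Set where
    uncrossed crossed : (l r : List ℕ) → Piece

  assemble : Piece → List ℕ
  assemble (uncrossed l r) = map (length r +_) l ++ length l + length r ∷ r
  assemble (crossed l r)   = map (suc (length r) +_) l ++
                             pred (length r) ∷ suc (length l + length r) ∷ map (skip (pred (length r))) r

  Permutation : List ℕ → Set
  Permutation w = IsPerm (length w) w

  -- Nothing is demanded about occurrences in `l` and `r`. The right part of a crossed piece is
  -- nonempty because it contains the entry that exceeds the one just before the maximum.
  data Valid (n : ℕ) : Piece → Set where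
    uncrossed : ∀ {l r} → Permutation l → Permutation r → length l + length r ≡ n → Valid n (uncrossed l r)
    crossed   : ∀ {l a r} → Permutation l → Permutation (a ∷ r) → suc (length l + length (a ∷ r)) ≡ n →
                Valid n (crossed l (a ∷ r))

  ∈-map+⁻ : ∀ k {l x} → Permutation l → x ∈ map (k +_) l → k ≤ x × x < length l + k
  ∈-map+⁻ k {l} pl x∈ with y , y∈l , refl ← ∈-map⁻ (k +_) x∈ =
    m≤m+n k y , subst (k + y <_) (+-comm k (length l)) (+-monoʳ-< k (bounded pl y∈l))

  +-increasing : ∀ k → StrictlyIncreasing (k +_)
  +-increasing k = +-monoʳ-< k

  map-increasing-Unique : ∀ {g} → StrictlyIncreasing g → ∀ {w} → Unique w → Unique (map g w)
  map-increasing-Unique mono = Uniqueₚ.map⁺ (increasing-injective mono)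

  module _ {l r : List ℕ} (pl : Permutation l) (pr : Permutation r) where

    private
      k m : ℕ
      k = length r
      m = length l + k

      u : List ℕ
      u = map (k +_) l

      r<m : ∀ {x} → x ∈ r → x < m
      r<m x∈r = <-≤-trans (bounded pr x∈r) (m≤n+m k (length l))

      u<m : ∀ {x} → x ∈ u → x < m
      u<m = proj₂ ∘ ∈-map+⁻ k pl

      w≤m : ∀ {x} → x ∈ m ∷ r → x ≤ m
      w≤m (here refl)  = ≤-refl
      w≤m (there x∈r) = <⇒≤ (r<m x∈r)

      above : Above m u (m ∷ r)
      above a∈u (here c≡m)  = inj₁ c≡m
      above a∈u (there c∈r) = inj₂ (<-≤-trans (bounded pr c∈r) (proj₁ (∈-map+⁻ k pl a∈u)))

      disjoint : ∀ {a} → a ∈ u → ¬ a ∈ m ∷ r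
      disjoint a∈u (here refl)  = <-irrefl refl (u<m a∈u)
      disjoint a∈u (there a∈r) = <-irrefl refl (<-≤-trans (bounded pr a∈r) (proj₁ (∈-map+⁻ k pl a∈u)))

      m∷r! : Unique (m ∷ r)
      m∷r! = Unique-∷⁺ (λ x∈r m≡x → <-irrefl (sym m≡x) (r<m x∈r)) (unique pr)

    IsPerm-uncrossed : IsPerm (suc m) (assemble (uncrossed l r))
    IsPerm-uncrossed = isPerm
      (trans (length-++ u) (trans (cong (_+ suc k) (length-map (k +_) l)) (+-suc (length l) k)))
      bounds
      (Unique-above u<m w≤m above disjoint (map-increasing-Unique (+-increasing k) (unique pl)) m∷r!)
      where
      bounds : ∀ {x} → x ∈ assemble (uncrossed l r) → x < suc m
      bounds x∈ with ∈-++⁻ u x∈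
      ... | inj₁ x∈u = m<n⇒m<1+n (u<m x∈u)
      ... | inj₂ x∈w = s≤s (w≤m x∈w)

    occ132-uncrossed : occ132 (assemble (uncrossed l r)) ≡ occ132 l + occ132 r
    occ132-uncrossed = trans (occ132-above u<m w≤m above) (cong₂ _+_
      (occ132-map (+-increasing k) l)
      (cong (_+ occ132 r) (occ132From-none m r (λ b∈r c∈r m<c → ⊥-elim (<-asym m<c (r<m c∈r))))))

    -- The maximum and each of the `length l` entries before it exceed all of `r`, which gives the
    -- factor `suc (length l)`.
    inv-uncrossed : inv (assemble (uncrossed l r)) ≡ inv l + inv r + suc (length l) * length r
    inv-uncrossed = trans (inv-++ k {u} {m ∷ r} (All.tabulate count-below)) (trans
      (cong₂ (λ i j → i + (length (filter (_<? m) r) + inv r) + j * k) (inv-map (+-increasing k) l) (length-map (k +_) l))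
      (trans (cong (λ z → inv l + (z + inv r) + length l * k) (count-all (_<? m) (All.tabulate r<m)))
        (solve 4 (λ i j n k → i :+ (k :+ j) :+ n :* k := i :+ j :+ (k :+ n :* k)) refl (inv l) (inv r) (length l) k)))
      where
      count-below : ∀ {a} → a ∈ u → length (filter (_<? a) (m ∷ r)) ≡ k
      count-below {a} a∈u = trans (cong length (filter-reject (_<? a) (λ m<a → <-asym m<a (u<m a∈u))))
        (count-all (_<? a) (All.tabulate (λ c∈r → <-≤-trans (bounded pr c∈r) (proj₁ (∈-map+⁻ k pl a∈u)))))

  -- The entry k of r is the only one that skip k moves.
  record SplitMax (k : ℕ) (r : List ℕ) : Set where
    constructor splitMax
    field
      {before after} : List ℕ
      skipped   : map (skip k) r ≡ before ++ suc k ∷ after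
      before<   : ∀ {x} → x ∈ before → x < k
      after<    : ∀ {x} → x ∈ after → x < k
      length≡k  : length before + length after ≡ k

  split-max : ∀ {k r} → IsPerm (suc k) r → SplitMax k r
  split-max {k} {r} p with IsPerm-max p
  ... | s , t , refl = splitMax
    (trans (map-++ (skip k) s (k ∷ t)) (cong₂ _++_ (fixed s<) (cong₂ _∷_ (skip-≡ k) (fixed t<))))
    s< t<
    (suc-injective (trans (sym (+-suc (length s) (length t))) (trans (sym (length-++ s)) (length≡ p))))
    where
    parts = Unique-++⁻ s (unique p)
    s< : ∀ {x} → x ∈ s → x < k
    s< x∈s = ≤∧≢⇒< (s≤s⁻¹ (bounded p (∈-++⁺ˡ x∈s))) (proj₂ (proj₂ parts) x∈s (here refl))
    t< : ∀ {x} → x ∈ t → x < k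
    t< x∈t = ≤∧≢⇒< (s≤s⁻¹ (bounded p (∈-++⁺ʳ s (there x∈t)))) (Unique-∷⁻ (proj₁ (proj₂ parts)) x∈t ∘ sym)
    fixed : ∀ {v} → (∀ {x} → x ∈ v → x < k) → map (skip k) v ≡ v
    fixed v< = map-id-local (All.tabulate (λ x∈v → skip-< (v< x∈v)))

  module _ {l r : List ℕ} (pl : Permutation l) {k′ : ℕ} (k≡ : length r ≡ suc k′) (pr : Permutation r) where

    private
      k m : ℕ
      k = suc k′
      m = suc (length l + k)

      u r↑ w : List ℕ
      u  = map (suc k +_) l
      r↑ = map (skip k′) r
      w  = k′ ∷ m ∷ r↑

      assembled : assemble (crossed l r) ≡ u ++ w
      assembled rewrite k≡ = refl

      r<k : ∀ {x} → x ∈ r → x < k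
      r<k x∈r = subst (_ <_) k≡ (bounded pr x∈r)

      r↑≤k : ∀ {x} → x ∈ r↑ → x ≤ k
      r↑≤k x∈ with y , y∈r , refl ← ∈-map⁻ (skip k′) x∈ = skip-≤ k′ (s≤s⁻¹ (r<k y∈r))

      k<m : k < m
      k<m = s≤s (m≤n+m k (length l))

      u-bounds : ∀ {x} → x ∈ u → k < x × x < m
      u-bounds {x} x∈u with a , b ← ∈-map+⁻ (suc k) pl x∈u = a , subst (x <_) (+-suc (length l) k) b

      w-cases : ∀ {x} → x ∈ w → x ≡ m ⊎ x ≤ k
      w-cases (here refl)         = inj₂ (n≤1+n k′)
      w-cases (there (here x≡m))  = inj₁ x≡m
      w-cases (there (there x∈r)) = inj₂ (r↑≤k x∈r)

      w≤m : ∀ {x} → x ∈ w → x ≤ m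
      w≤m x∈w with w-cases x∈w
      ... | inj₁ refl = ≤-refl
      ... | inj₂ x≤k  = ≤-trans x≤k (<⇒≤ k<m)

      u<m : ∀ {x} → x ∈ u → x < m
      u<m = proj₂ ∘ u-bounds

      above : Above m u w
      above a∈u c∈w with w-cases c∈w
      ... | inj₁ c≡m = inj₁ c≡m
      ... | inj₂ c≤k = inj₂ (≤-<-trans c≤k (proj₁ (u-bounds a∈u)))

      disjoint : ∀ {a} → a ∈ u → ¬ a ∈ w
      disjoint a∈u a∈w with above a∈u a∈w
      ... | inj₁ refl = <-irrefl refl (u<m a∈u)
      ... | inj₂ a<a  = <-irrefl refl a<a

      k′∉r↑ : ∀ {x} → x ∈ r↑ → k′ ≢ x
      k′∉r↑ x∈ k′≡x with y , _ , refl ← ∈-map⁻ (skip k′) x∈ = skip-≢ k′ y (sym k′≡x)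

      w! : Unique w
      w! = Unique-∷⁺ (λ { (here refl) k′≡m → <-irrefl k′≡m (<-trans (n<1+n k′) k<m) ; (there x∈) → k′∉r↑ x∈ })
          (Unique-∷⁺ (λ x∈ m≡x → <-irrefl (sym m≡x) (≤-<-trans (r↑≤k x∈) k<m))
            (map-increasing-Unique (skip-increasing k′) (unique pr)))

      r↑<m : ∀ {x} → x ∈ r↑ → x < m
      r↑<m x∈ = ≤-<-trans (r↑≤k x∈) k<m

      -- The maximum of `r` is moved to `k` and is the only entry of `r↑` above `k′`; all others
      -- stay below `k′`.
      count-r↑ : length (filter (_<? k′) r↑) ≡ k′ × length (filter (between? k′ m) r↑) ≡ 1
      count-r↑ with splitMax {s} {t} eq s< t< len ← split-max (subst (λ k → IsPerm k r) k≡ pr) rewrite eq =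
        trans (count-++ (_<? k′) s (k ∷ t)) (trans (cong₂ _+_
          (count-all (_<? k′) (All.tabulate s<))
          (trans (cong length (filter-reject (_<? k′) (λ k<k′ → <-asym k<k′ (n<1+n k′)))) (count-all (_<? k′) (All.tabulate t<)))) len) ,
        trans (count-++ (between? k′ m) s (k ∷ t)) (cong₂ _+_
          (count-none (between? k′ m) {s} (All.tabulate (λ x∈s (k′<x , _) → <-asym k′<x (s< x∈s))))
          (trans (cong length (filter-accept (between? k′ m) {k} {t} (n<1+n k′ , k<m)))
            (cong suc (count-none (between? k′ m) {t} (All.tabulate (λ x∈t (k′<x , _) → <-asym k′<x (t< x∈t)))))))

    IsPerm-crossed : IsPerm (suc (suc (length l + length r))) (assemble (crossed l r))
    IsPerm-crossed = subst₂ IsPerm (sym (cong (λ z → suc (suc (length l + z))) k≡)) (sym assembled) (isPerm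
      (trans (length-++ u) (trans (cong₂ (λ a b → a + suc (suc b)) (length-map (suc k +_) l) (trans (length-map (skip k′) r) k≡))
        (trans (+-suc (length l) (suc k)) (cong suc (+-suc (length l) k)))))
      bounds
      (Unique-above u<m w≤m above disjoint (map-increasing-Unique (+-increasing (suc k)) (unique pl)) w!))
      where
      bounds : ∀ {x} → x ∈ u ++ w → x < suc m
      bounds x∈ with ∈-++⁻ u x∈
      ... | inj₁ x∈u = m<n⇒m<1+n (u<m x∈u)
      ... | inj₂ x∈w = s≤s (w≤m x∈w)

    -- The additional occurrence is `k′ m k`. No other one starts at `k′`: inside `r↑` it would need
    -- two values above `k′`, but all entries of `r↑` are at most `k`.
    occ132-crossed : occ132 (assemble (crossed l r)) ≡ suc (occ132 l + occ132 r)
    occ132-crossed = trans (cong occ132 assembled) (trans (occ132-above u<m w≤m above) (trans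
      (cong₂ _+_ (occ132-map (+-increasing (suc k)) l)
        (cong₂ _+_
          (cong₂ _+_ (proj₂ count-r↑)
            (occ132From-none k′ r↑ (λ b∈ c∈ k′<c c<b → <-irrefl refl (≤-<-trans k′<c (<-≤-trans c<b (r↑≤k b∈))))))
          (cong₂ _+_ (occ132From-none m r↑ (λ b∈ c∈ m<c → ⊥-elim (<-asym m<c (r↑<m c∈))))
            (occ132-map (skip-increasing k′) r))))
      (+-suc (occ132 l) (occ132 r))))

    -- Each entry of the left part exceeds `k′` and all of `r↑`, hence `suc (length r)` entries;
    -- `k′` exceeds all of `r↑` but one, and `m` exceeds all of it.
    inv-crossed : inv (assemble (crossed l r)) ≡ inv l + inv r + (length l * suc (length r) + (pred (length r) + length r))
    inv-crossed = trans (cong inv assembled) (trans (inv-++ (suc k) {u} {w} (All.tabulate count-below)) (trans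
      (cong₂ (λ i j → i + inv w + j * suc k) (inv-map (+-increasing (suc k)) l) (length-map (suc k +_) l))
      (trans (cong (λ z → inv l + z + length l * suc k) inv-w)
      (trans (solve 5 (λ i j n k k′ → i :+ (k′ :+ (k :+ j)) :+ n :* (con 1 :+ k) := i :+ j :+ (n :* (con 1 :+ k) :+ (k′ :+ k)))
               refl (inv l) (inv r) (length l) k k′)
        (cong (λ z → inv l + inv r + (length l * suc z + (pred z + z))) (sym k≡))))))
      where
      count-below : ∀ {a} → a ∈ u → length (filter (_<? a) w) ≡ suc k
      count-below {a} a∈u with k<a , a<m ← u-bounds a∈u =
        trans (cong length (filter-accept (_<? a) {k′} {m ∷ r↑} (<-trans (n<1+n k′) k<a))) (cong suc
          (trans (cong length (filter-reject (_<? a) {m} {r↑} (λ m<a → <-asym m<a a<m)))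
            (trans (count-all (_<? a) (All.tabulate (λ c∈ → ≤-<-trans (r↑≤k c∈) k<a)))
              (trans (length-map (skip k′) r) k≡))))
      inv-w : inv w ≡ k′ + (k + inv r)
      inv-w = cong₂ _+_
        (trans (cong length (filter-reject (_<? k′) {m} {r↑} (λ m<k′ → <-asym m<k′ (<-trans (n<1+n k′) k<m)))) (proj₁ count-r↑))
        (cong₂ _+_ (trans (count-all (_<? m) (All.tabulate r↑<m)) (trans (length-map (skip k′) r) k≡))
                   (inv-map (skip-increasing k′) r))

  -- Assembly is injective.

  left right : Piece → List ℕ
  left (uncrossed l r)  = map (length r +_) l
  left (crossed l r)    = map (suc (length r) +_) l ++ pred (length r) ∷ []
  right (uncrossed l r) = r
  right (crossed l r)   = map (skip (pred (length r))) r

  assemble-split : ∀ {n p} → Valid n p → assemble p ≡ left p ++ n ∷ right p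
  assemble-split (uncrossed _ _ refl) = refl
  assemble-split (crossed {l} {a} {r} _ _ refl) =
    sym (++-assoc (map (suc (suc (length r)) +_) l) (length r ∷ []) (suc (length l + suc (length r)) ∷ map (skip (length r)) (a ∷ r)))

  assemble-IsPerm : ∀ {n p} → Valid n p → IsPerm (suc n) (assemble p)
  assemble-IsPerm (uncrossed pl pr refl) = IsPerm-uncrossed pl pr
  assemble-IsPerm (crossed pl pr refl)   = IsPerm-crossed pl refl pr

  ++-∷-injective : ∀ {m : ℕ} u {v} u′ {v′} → m ∉ u → m ∉ u′ → u ++ m ∷ v ≡ u′ ++ m ∷ v′ → u ≡ u′ × v ≡ v′
  ++-∷-injective []      []       _   _    refl = refl , refl
  ++-∷-injective []      (b ∷ u′) _   m∉u′ refl = ⊥-elim (m∉u′ (here refl))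
  ++-∷-injective (a ∷ u) []       m∉u _    refl = ⊥-elim (m∉u (here refl))
  ++-∷-injective (a ∷ u) (b ∷ u′) m∉u m∉u′ eq with refl , eq′ ← ∷-injective eq
    with refl , refl ← ++-∷-injective u u′ (m∉u ∘ there) (m∉u′ ∘ there) eq′ = refl , refl

  n∉left : ∀ {n p} → Valid n p → n ∉ left p
  n∉left {n} {p} v n∈ = proj₂ (proj₂ (Unique-++⁻ (left p) (subst Unique (assemble-split v) (unique (assemble-IsPerm v)))))
    n∈ (here refl) refl

  -- Equal right factors would have equal lengths, forcing `length r` to be one more than the length
  -- of the tail of the crossed right part. That tail length is itself an entry of the crossed left
  -- factor, yet entries of the uncrossed left factor are at least `length r`.
  uncrossed≢crossed : ∀ {n l r l′ r′} → Valid n (uncrossed l r) → Valid n (crossed l′ r′) →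
                      left (uncrossed l r) ≢ left (crossed l′ r′) ⊎ right (uncrossed l r) ≢ right (crossed l′ r′)
  uncrossed≢crossed {l = l} {r} {l′} (uncrossed pl _ _) (crossed {r = r′} _ _ _) with length r ≤? length r′
  ... | yes |r|≤|r′| = inj₂ λ eq → <-irrefl refl (<-≤-trans (n<1+n (length r′))
          (≤-trans (≤-reflexive (sym (trans (cong length eq) (cong suc (length-map (skip (length r′)) r′))))) |r|≤|r′|))
  ... | no  |r|≰|r′| = inj₁ λ eq → |r|≰|r′| (proj₁ (∈-map+⁻ (length r) pl
          (subst (length r′ ∈_) (sym eq) (∈-++⁺ʳ (map (suc (suc (length r′)) +_) l′) (here refl)))))

  -- Within one kind, the length of the right factor determines the relabellings, and these are
  -- injective.
  parts-injective : ∀ {n p p′} → Valid n p → Valid n p′ → left p ≡ left p′ → right p ≡ right p′ → p ≡ p′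
  parts-injective (uncrossed {r = r} _ _ _) (uncrossed _ _ _) eqˡ refl =
    cong (λ l → uncrossed l r) (map-injective (increasing-injective (+-increasing (length r))) eqˡ)
  parts-injective (crossed {l} {a} {r} _ _ _) (crossed {l′} {a′} {r′} _ _ _) eqˡ eqʳ =
    cong₂ crossed
      (map-injective (increasing-injective (+-increasing (suc k)))
        (∷ʳ-injectiveˡ (map (suc k +_) l) (map (suc k +_) l′)
          (trans eqˡ (cong (λ k → map (suc k +_) l′ ++ pred k ∷ []) (sym k≡k′)))))
      (map-injective (increasing-injective (skip-increasing (length r)))
        (trans eqʳ (cong (λ k → map (skip (pred k)) (a′ ∷ r′)) (sym k≡k′))))
    where
    k : ℕ
    k = suc (length r)
    k≡k′ : k ≡ suc (length r′)
    k≡k′ = trans (sym (length-map (skip (length r)) (a ∷ r))) (trans (cong length eqʳ) (length-map (skip (length r′)) (a′ ∷ r′)))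
  parts-injective v@(uncrossed _ _ _) v′@(crossed _ _ _) eqˡ eqʳ with uncrossed≢crossed v v′
  ... | inj₁ neq = ⊥-elim (neq eqˡ)
  ... | inj₂ neq = ⊥-elim (neq eqʳ)
  parts-injective v@(crossed _ _ _) v′@(uncrossed _ _ _) eqˡ eqʳ with uncrossed≢crossed v′ v
  ... | inj₁ neq = ⊥-elim (neq (sym eqˡ))
  ... | inj₂ neq = ⊥-elim (neq (sym eqʳ))

  assemble-injective : ∀ {n p p′} → Valid n p → Valid n p′ → assemble p ≡ assemble p′ → p ≡ p′
  assemble-injective {p = p} {p′} v v′ eq
    with eqˡ , eqʳ ← ++-∷-injective (left p) (left p′) (n∉left v) (n∉left v′)
                       (trans (sym (assemble-split v)) (trans eq (assemble-split v′)))
    = parts-injective v v′ eqˡ eqʳ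

  -- Every permutation with at most one occurrence comes from a piece.

  preimage : ∀ (g : ℕ → ℕ) {w} → (∀ {x} → x ∈ w → ∃ λ y → g y ≡ x) → ∃ λ v → map g v ≡ w
  preimage g {[]}    pre = [] , refl
  preimage g {x ∷ w} pre with y , refl ← pre (here refl) | v , refl ← preimage g (pre ∘ there) = y ∷ v , refl

  shifted : ∀ k {u} → Unique u → (∀ {x} → x ∈ u → k ≤ x × x < length u + k) →
            ∃ λ l → map (k +_) l ≡ u × Permutation l
  shifted k {u = u} u! bounds with l , refl ← preimage (k +_) {u} (λ {x} x∈ → x ∸ k , m+[n∸m]≡n (proj₁ (bounds x∈))) =
    l , refl , isPerm refl
      (λ {y} y∈ → +-cancelˡ-< k y (length l)
        (subst (k + y <_) (trans (cong (_+ k) (length-map (k +_) l)) (+-comm (length l) k)) (proj₂ (bounds (∈-map⁺ (k +_) y∈)))))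
      (Uniqueₚ.map⁻ u!)

  interval-bound : ∀ c n {w} → c < n → Unique w → (∀ {x} → x ∈ w → c < x × x < n) → length w + suc c ≤ n
  interval-bound c n c<n w! bounds = subst (_ ≤_) (m∸n+n≡m c<n) (+-monoˡ-≤ (suc c) (pigeonhole (suc c) n w! bounds))

  -- Pigeonhole in both directions: all of `v` lies below a given `x` in `u`, so `length v ≤ x`; and
  -- `u` lies strictly between a given `c` in `v` and `n`, so `c < length v`. Hence subtracting
  -- `length v` from `u` leaves a permutation, and `v` already is one.
  decompose-uncrossed : ∀ {n} u {v} → IsPerm (suc n) (u ++ n ∷ v) → length u + length v ≡ n →
                        (∀ {x y} → x ∈ u → y ∈ v → y < x) →
                        ∃ λ p → Valid n p × assemble p ≡ u ++ n ∷ v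
  decompose-uncrossed {n} u {v} π len v<u
    with u! , nv! , u#nv ← Unique-++⁻ u (unique π)
    with v! ← Uniqueₚ.drop⁺ 1 nv!
    with u<n ← (λ {x} (x∈u : x ∈ u) → ≤∧≢⇒< (s≤s⁻¹ (bounded π (∈-++⁺ˡ x∈u))) (u#nv x∈u (here refl)))
    with l , refl , pl ← shifted (length v) u! (λ {x} x∈u →
                           pigeonhole 0 x v! (λ y∈v → z≤n , v<u x∈u y∈v) , subst (x <_) (sym len) (u<n x∈u))
    = uncrossed l v ,
      uncrossed pl pv len′ ,
      cong (λ m → map (length v +_) l ++ m ∷ v) len′
    where
    len′ : length l + length v ≡ n
    len′ = trans (cong (_+ length v) (sym (length-map (length v +_) l))) len
    pv : Permutation v
    pv = isPerm refl (λ {c} c∈v → +-cancelˡ-≤ (length u) (suc c) (length v) (subst (length u + suc c ≤_) (sym len)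
      (interval-bound c n (≤∧≢⇒< (s≤s⁻¹ (bounded π (∈-++⁺ʳ u (there c∈v)))) (λ c≡n → Unique-∷⁻ nv! c∈v (sym c≡n))) u!
        (λ x∈u → v<u x∈u c∈v , u<n x∈u)))) v!

  length-middle : ∀ {A : Set} (s : List A) {x t} → length (s ++ x ∷ t) ≡ suc (length s + length t)
  length-middle s {x} {t} = trans (length-++ s) (+-suc (length s) (length t))

  unskip : ∀ {k r} → Unique (map (skip k) r) → (∀ {x} → x ∈ map (skip k) r → x ≤ suc k) → length r ≡ suc k → Permutation r
  unskip {k} {r} r! r≤k len = isPerm refl
    (λ {x} x∈r → subst (x <_) (sym len) (≰⇒> (λ k<x → <-irrefl refl
      (≤-<-trans (r≤k (∈-map⁺ (skip k) x∈r)) (subst (_< skip k x) (skip-≡ k) (skip-increasing k k<x))))))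
    (Uniqueₚ.map⁻ r!)

  module _ {n} u {a} s {c t} (π : IsPerm (suc n) (u ++ a ∷ n ∷ s ++ c ∷ t))
           (len : suc (length u + length (s ++ c ∷ t)) ≡ n) (a<c : a < c)
           (v<a : ∀ {y} → y ∈ s ++ c ∷ t → y ≡ c ⊎ y < a) (c<u : ∀ {x} → x ∈ u → c < x) where

    private
      v : List ℕ
      v = s ++ c ∷ t

      parts  = Unique-++⁻ u (unique π)
      u!     = proj₁ parts
      anv!   = proj₁ (proj₂ parts)
      u#anv  = proj₂ (proj₂ parts)
      nv!    = Uniqueₚ.drop⁺ 1 anv!
      v!     = Uniqueₚ.drop⁺ 1 nv!
      parts′ = Unique-++⁻ s v!

      c∈v : c ∈ v
      c∈v = ∈-++⁺ʳ s (here refl)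

      u<n : ∀ {x} → x ∈ u → x < n
      u<n x∈u = ≤∧≢⇒< (s≤s⁻¹ (bounded π (∈-++⁺ˡ x∈u))) (u#anv x∈u (there (here refl)))

      c<n : c < n
      c<n = ≤∧≢⇒< (s≤s⁻¹ (bounded π (∈-++⁺ʳ u (there (there c∈v))))) (Unique-∷⁻ nv! c∈v ∘ sym)

      st<a : ∀ {y} → y ∈ s ++ t → y < a
      st<a y∈ with ∈-++⁻ s y∈
      st<a y∈ | inj₁ y∈s with v<a (∈-++⁺ˡ y∈s)
      ... | inj₁ y≡c = ⊥-elim (proj₂ (proj₂ parts′) y∈s (here refl) y≡c)
      ... | inj₂ y<a = y<a
      st<a y∈ | inj₂ y∈t with v<a (∈-++⁺ʳ s (there y∈t))
      ... | inj₁ y≡c = ⊥-elim (Unique-∷⁻ (proj₁ (proj₂ parts′)) y∈t (sym y≡c))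
      ... | inj₂ y<a = y<a

      -- Start of a squeeze. `u` lies strictly between `c` and `n`, which bounds `c` by `length v`;
      -- `v` without `c` lies below `a`, which bounds `length v` by `suc a`. With `a < c` both
      -- bounds are tight, so `a` and `c` are consecutive values.
      c≤|v| : c ≤ length v
      c≤|v| = +-cancelˡ-≤ (length u) c (length v) (s≤s⁻¹ (subst₂ _≤_ (+-suc (length u) c) (sym len)
        (interval-bound c n c<n u! (λ x∈u → c<u x∈u , u<n x∈u))))

      |v|≤1+a : length v ≤ suc a
      |v|≤1+a = subst (_≤ suc a) (sym (trans (length-middle s) (cong suc (sym (length-++ s)))))
        (s≤s (pigeonhole 0 a (Unique-++⁺ (proj₁ parts′) (Uniqueₚ.drop⁺ 1 (proj₁ (proj₂ parts′)))
          (λ x∈s y∈t → proj₂ (proj₂ parts′) x∈s (there y∈t))) (λ y∈ → z≤n , st<a y∈)))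

      c≡1+a : c ≡ suc a
      c≡1+a = ≤-antisym (≤-trans c≤|v| |v|≤1+a) a<c

      |v|≡1+a : length v ≡ suc a
      |v|≡1+a = ≤-antisym |v|≤1+a (subst (_≤ length v) c≡1+a c≤|v|)

      v≤1+a : ∀ {y} → y ∈ v → y ≤ suc a
      v≤1+a y∈ with v<a y∈
      ... | inj₁ y≡c = ≤-reflexive (trans y≡c c≡1+a)
      ... | inj₂ y<a = m≤n⇒m≤1+n (<⇒≤ y<a)

      v-preimage : ∀ {y} → y ∈ v → ∃ λ x → skip a x ≡ y
      v-preimage {y} y∈ with v<a y∈
      ... | inj₁ y≡c = a , trans (skip-≡ a) (sym (trans y≡c c≡1+a))
      ... | inj₂ y<a = y , skip-< y<a

      u-bounds : ∀ {x} → x ∈ u → suc (suc a) ≤ x × x < length u + suc (suc a)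
      u-bounds {x} x∈u = subst (_< x) c≡1+a (c<u x∈u) ,
        subst (x <_) (trans (sym len) (trans (cong (λ z → suc (length u + z)) |v|≡1+a) (sym (+-suc (length u) (suc a))))) (u<n x∈u)

    decompose-crossed : ∃ λ p → Valid n p × assemble p ≡ u ++ a ∷ n ∷ v
    decompose-crossed with shifted (suc (suc a)) u! u-bounds | preimage (skip a) v-preimage
    ... | l , l↦u , pl | [] , r↦v = ⊥-elim (0≢1+n (trans (cong length r↦v) |v|≡1+a))
    ... | l , l↦u , pl | r@(_ ∷ r′) , r↦v = crossed l r , crossed pl pr size , shape
      where
      |r|≡1+a : length r ≡ suc a
      |r|≡1+a = trans (sym (length-map (skip a) r)) (trans (cong length r↦v) |v|≡1+a)
      pr : Permutation r
      pr = unskip (subst Unique (sym r↦v) v!) (λ {x} x∈ → v≤1+a (subst (x ∈_) r↦v x∈)) |r|≡1+a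
      size : suc (length l + length r) ≡ n
      size = trans (cong₂ (λ i j → suc (i + j)) (trans (sym (length-map (suc (suc a) +_) l)) (cong length l↦u))
                     (trans |r|≡1+a (sym |v|≡1+a))) len
      shape : assemble (crossed l r) ≡ u ++ a ∷ n ∷ v
      shape = trans (cong₂ (λ k m → map (suc k +_) l ++ pred k ∷ m ∷ map (skip (pred k)) r) |r|≡1+a size)
        (cong₂ (λ u v → u ++ a ∷ n ∷ v) l↦u r↦v)

  -- One occurrence starts at `x` and the other inside `w`, so `occ132` counts them in different
  -- summands.
  occ132-two : ∀ s {x t w} → 1 ≤ occ132From x (t ++ w) → 1 ≤ occ132 w → 2 ≤ occ132 (s ++ x ∷ t ++ w)
  occ132-two s {x} {t} {w} p r = ≤-trans (+-mono-≤ p (≤-trans r (occ132-suffix t w))) (occ132-suffix s (x ∷ t ++ w))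

  -- A pair a < c across the maximum n already gives the occurrence a n c;
  -- anything else out of place in a crossed piece gives another one.
  module _ {n} u {a} u′ s {c t} (π : IsPerm (suc n) (u ++ a ∷ u′ ++ n ∷ s ++ c ∷ t)) (a≤c : a ≤ c)
           (occ≤1 : occ132 (u ++ a ∷ u′ ++ n ∷ s ++ c ∷ t) ≤ 1) where

    private
      v : List ℕ
      v = s ++ c ∷ t

      au′nv! : Unique (a ∷ u′ ++ n ∷ v)
      au′nv! = proj₁ (proj₂ (Unique-++⁻ u (unique π)))

      nv! : Unique (n ∷ v)
      nv! = proj₁ (proj₂ (Unique-++⁻ (a ∷ u′) au′nv!))

      v<n : ∀ {y} → y ∈ v → y < n
      v<n y∈v = ≤∧≢⇒< (s≤s⁻¹ (bounded π (∈-++⁺ʳ u (there (∈-++⁺ʳ u′ (there y∈v)))))) (Unique-∷⁻ nv! y∈v ∘ sym)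

      c∈v : c ∈ v
      c∈v = ∈-++⁺ʳ s (here refl)

      a<c : a < c
      a<c = ≤∧≢⇒< a≤c (Unique-∷⁻ au′nv! (∈-++⁺ʳ u′ (there c∈v)))

      occurrence : ∀ {x y} p → y ∈ v → x < y → 1 ≤ occ132From x (p ++ n ∷ v)
      occurrence p y∈v x<y = occ132From-member p y∈v x<y (v<n y∈v)

      a-occurrence : 1 ≤ occ132From a (u′ ++ n ∷ v)
      a-occurrence = occurrence u′ c∈v a<c

      not-two : ¬ 2 ≤ occ132 (u ++ a ∷ u′ ++ n ∷ v)
      not-two 2≤ = <-irrefl refl (≤-trans 2≤ occ≤1)

    -- Let `b` be the entry right after `a`. If `c < b`, then `a b c` is a second occurrence;
    -- otherwise `b < c` and `b n c` is one.
    nothing-between : u′ ≡ []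
    nothing-between = lemma u′ refl
      where
      lemma : ∀ p → p ≡ u′ → u′ ≡ []
      lemma []      refl = refl
      lemma (b ∷ p) refl with c <? b
      ... | yes c<b = ⊥-elim (not-two (≤-trans
            (≤-trans (+-mono-≤ (count-member (between? a b) (∈-++⁺ʳ p (there c∈v)) (a<c , c<b)) (occurrence p c∈v a<c)) (m≤m+n _ _))
            (occ132-suffix u (a ∷ b ∷ p ++ n ∷ v))))
      ... | no  c≮b = ⊥-elim (not-two (occ132-two u {a} {[]} {b ∷ p ++ n ∷ v} a-occurrence (≤-trans (occurrence p c∈v b<c) (m≤m+n _ _))))
        where
        b<c : b < c
        b<c = ≤∧≢⇒< (≮⇒≥ c≮b) (Unique-∷⁻ (Uniqueₚ.drop⁺ 1 au′nv!) (∈-++⁺ʳ p (there c∈v)))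

    -- An entry `y` of `v` other than `c` with `a < y` would give `a n y` beside `a n c`.
    right-below : ∀ {y} → y ∈ v → y ≡ c ⊎ y < a
    right-below {y} y∈v with y ≟ c | a <? y
    ... | yes y≡c | _       = inj₁ y≡c
    ... | no  _   | no a≮y  = inj₂ (≤∧≢⇒< (≮⇒≥ a≮y) (Unique-∷⁻ au′nv! (∈-++⁺ʳ u′ (there y∈v)) ∘ sym))
    ... | no  y≢c | yes a<y = ⊥-elim (not-two (begin
      2                                        ≤⟨ count-two (between? a n) y≢c y∈v c∈v (a<y , v<n y∈v) (a<c , v<n c∈v) ⟩
      length (filter (between? a n) v)         ≤⟨ m≤m+n _ _ ⟩
      occ132From a (n ∷ v)                     ≤⟨ occ132From-suffix a u′ (n ∷ v) ⟩
      occ132From a (u′ ++ n ∷ v)               ≤⟨ m≤m+n _ _ ⟩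
      occ132 (a ∷ u′ ++ n ∷ v)                 ≤⟨ occ132-suffix u (a ∷ u′ ++ n ∷ v) ⟩
      occ132 (u ++ a ∷ u′ ++ n ∷ v)            ∎))
      where open ≤-Reasoning

    -- An entry `x` of `u` with `x < c` would give `x n c` beside `a n c`.
    left-above : ∀ {x} → x ∈ u → c < x
    left-above {x} x∈u with x <? c
    ... | no  x≮c = ≤∧≢⇒< (≮⇒≥ x≮c) (proj₂ (proj₂ (Unique-++⁻ u (unique π))) x∈u (there (∈-++⁺ʳ u′ (there c∈v))) ∘ sym)
    ... | yes x<c with p , p′ , refl ← ∈-∃++ x∈u =
      ⊥-elim (not-two (subst (λ w → 2 ≤ occ132 w) (sym (++-assoc p (x ∷ p′) (a ∷ u′ ++ n ∷ v)))
          (occ132-two p {x} {p′} {a ∷ u′ ++ n ∷ v}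
            (≤-trans (occurrence (a ∷ u′) c∈v x<c) (occ132From-suffix x p′ (a ∷ u′ ++ n ∷ v)))
            (≤-trans a-occurrence (m≤m+n _ _)))))

    decompose-ascent : ∃ λ p → Valid n p × assemble p ≡ u ++ a ∷ u′ ++ n ∷ v
    decompose-ascent with refl ← nothing-between = decompose-crossed u s π
      (suc-injective (trans (cong suc (sym (+-suc (length u) (length v)))) (trans (sym (length-middle u)) (length≡ π))))
      a<c right-below left-above

  decompose : ∀ {n w} → IsPerm (suc n) w → occ132 w ≤ 1 → ∃ λ p → Valid n p × assemble p ≡ w
  decompose {n} π occ≤1 with IsPerm-max π
  ... | u , v , refl with All.all? (λ a → All.all? (_<? a) v) u
  ...   | yes v<u = decompose-uncrossed u π (suc-injective (trans (sym (length-middle u)) (length≡ π)))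
                      (λ x∈u y∈v → All.lookup (All.lookup v<u x∈u) y∈v)
  ...   | no  v≮u
          with a , a∈u , v≮a ← find (Allₚ.¬All⇒Any¬ (λ a → All.all? (_<? a) v) u v≮u)
          with c , c∈v , c≮a ← find (Allₚ.¬All⇒Any¬ (_<? a) v v≮a)
          with u₁ , u₂ , refl ← ∈-∃++ a∈u
          with s , t , refl ← ∈-∃++ c∈v
          rewrite ++-assoc u₁ (a ∷ u₂) (n ∷ s ++ c ∷ t) = decompose-ascent u₁ u₂ s π (≮⇒≥ c≮a) occ≤1

open import Data.Integer using (+_)

module PowerSeries where

  open import Algebra.Bundles using (CommutativeRing)
  import Algebra.Solver.Ring as RingSolver
  open import Algebra.Solver.Ring.AlmostCommutativeRing
    using (AlmostCommutativeRing; fromCommutativeRing; _-Raw-AlmostCommutative⟶_)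
  open import Data.List using (map; foldr; upTo)
  open import Data.List.Properties using (map-applyUpTo; map-upTo)
  open import Data.Maybe using (Maybe; just; nothing)
  open import Data.Nat as ℕ using (ℕ; zero; suc; _∸_)
  import Data.Nat.Properties as ℕₚ
  open import Data.Product using (_,_; proj₁; proj₂)
  open import Data.Rational using (_+_; _*_)
  open import Data.Rational.Properties
    using (+-*-commutativeRing; +-identityˡ; +-identityʳ; +-assoc; +-comm; +-inverseˡ; +-inverseʳ;
           *-identityˡ; *-identityʳ; *-zeroˡ; *-zeroʳ; *-assoc; *-comm; *-distribˡ-+; neg-distribˡ-*)
    renaming (_≟_ to _≟ℚ_)
  open import Data.Rational.Solver using (module +-*-Solver)
  open import Level using (0ℓ)
  open import Relation.Binary.PropositionalEquality
    using (refl; sym; trans; cong; cong₂; _≗_; module ≡-Reasoning)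
  open import Relation.Nullary using (yes; no)
  open +-*-Solver using ()
    renaming (solve to solveℚ; con to conℚ; _:=_ to _≔_; _:+_ to _⊞_; _:*_ to _⊠_; _:-_ to _⊟_; :-_ to ⊟_)

  -- The commutative ring of formal power series over the rationals.

  shift : Series → Series
  shift f n = f (suc n)

  -- Splitting off the first summand replaces the truncated subtraction in the Cauchy product by
  -- recursion on the degree; the ring laws below are proved by this recursion.
  ⊛-suc : ∀ f g n → (f ⊛ g) (suc n) ≡ f 0 * g (suc n) + (shift f ⊛ g) n
  ⊛-suc f g n = cong (λ l → f 0 * g (suc n) + foldr _+_ 0ℚ l)
    (trans (map-applyUpTo suc (λ k → f k * g (suc n ∸ k)) (suc n))
           (sym (map-upTo (λ k → f (suc k) * g (n ∸ k)) (suc n))))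

  ⊛-cong : ∀ {f f′ g g′} → f ≗ f′ → g ≗ g′ → (f ⊛ g) ≗ (f′ ⊛ g′)
  ⊛-cong p r zero = cong₂ (λ a b → a * b + 0ℚ) (p 0) (r 0)
  ⊛-cong {f} {f′} {g} {g′} p r (suc n) =
    trans (⊛-suc f g n)
      (trans (cong₂ _+_ (cong₂ _*_ (p 0) (r (suc n))) (⊛-cong (λ k → p (suc k)) r n))
        (sym (⊛-suc f′ g′ n)))

  ⊛-zeroˡ : ∀ f g → (∀ n → f n ≡ 0ℚ) → ∀ n → (f ⊛ g) n ≡ 0ℚ
  ⊛-zeroˡ f g f≡0 zero = trans (+-identityʳ _) (trans (cong (_* g 0) (f≡0 0)) (*-zeroˡ (g 0)))
  ⊛-zeroˡ f g f≡0 (suc n) = begin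
    (f ⊛ g) (suc n)                     ≡⟨ ⊛-suc f g n ⟩
    f 0 * g (suc n) + (shift f ⊛ g) n   ≡⟨ cong₂ _+_ (trans (cong (_* g (suc n)) (f≡0 0)) (*-zeroˡ (g (suc n))))
                                                     (⊛-zeroˡ (shift f) g (λ k → f≡0 (suc k)) n) ⟩
    0ℚ + 0ℚ                             ≡⟨ +-identityˡ 0ℚ ⟩
    0ℚ                                  ∎
    where open ≡-Reasoning

  C : ℚ → Series
  C c = poly (c ∷ [])

  X : Series
  X = poly (0ℚ ∷ 1ℚ ∷ [])

  ·-as-⊛ : ∀ c f → (c · f) ≗ (C c ⊛ f)
  ·-as-⊛ c f zero    = sym (+-identityʳ _)
  ·-as-⊛ c f (suc n) = sym (trans (⊛-suc (C c) f n)
    (trans (cong (_+_ (c * f (suc n))) (⊛-zeroˡ (shift (C c)) f (λ _ → refl) n)) (+-identityʳ _)))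

  X⊛-zero : ∀ f → (X ⊛ f) 0 ≡ 0ℚ
  X⊛-zero f = trans (+-identityʳ _) (*-zeroˡ (f 0))

  X⊛-suc : ∀ f n → (X ⊛ f) (suc n) ≡ f n
  X⊛-suc f n = begin
    (X ⊛ f) (suc n)                     ≡⟨ ⊛-suc X f n ⟩
    0ℚ * f (suc n) + (shift X ⊛ f) n    ≡⟨ cong₂ _+_ (*-zeroˡ (f (suc n))) (⊛-cong {shift X} {C 1ℚ} {f} {f} (λ { zero → refl ; (suc _) → refl }) (λ _ → refl) n) ⟩
    0ℚ + (C 1ℚ ⊛ f) n                   ≡⟨ +-identityˡ _ ⟩
    (C 1ℚ ⊛ f) n                        ≡⟨ ·-as-⊛ 1ℚ f n ⟨
    1ℚ * f n                            ≡⟨ *-identityˡ (f n) ⟩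
    f n                                 ∎
    where open ≡-Reasoning

  ⊛-distribʳ : ∀ h f g → ((f ⊕ g) ⊛ h) ≗ ((f ⊛ h) ⊕ (g ⊛ h))
  ⊛-distribʳ h f g zero = solveℚ 3 (λ a b c → (a ⊞ b) ⊠ c ⊞ conℚ 0ℚ ≔ (a ⊠ c ⊞ conℚ 0ℚ) ⊞ (b ⊠ c ⊞ conℚ 0ℚ)) refl (f 0) (g 0) (h 0)
  ⊛-distribʳ h f g (suc n) = begin
    ((f ⊕ g) ⊛ h) (suc n)
      ≡⟨ ⊛-suc (f ⊕ g) h n ⟩
    (f 0 + g 0) * h (suc n) + ((shift f ⊕ shift g) ⊛ h) n
      ≡⟨ cong (_+_ ((f 0 + g 0) * h (suc n))) (⊛-distribʳ h (shift f) (shift g) n) ⟩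
    (f 0 + g 0) * h (suc n) + ((shift f ⊛ h) n + (shift g ⊛ h) n)
      ≡⟨ solveℚ 5 (λ a b c d e → (a ⊞ b) ⊠ c ⊞ (d ⊞ e) ≔ (a ⊠ c ⊞ d) ⊞ (b ⊠ c ⊞ e)) refl
           (f 0) (g 0) (h (suc n)) ((shift f ⊛ h) n) ((shift g ⊛ h) n) ⟩
    (f 0 * h (suc n) + (shift f ⊛ h) n) + (g 0 * h (suc n) + (shift g ⊛ h) n)
      ≡⟨ cong₂ _+_ (⊛-suc f h n) (⊛-suc g h n) ⟨
    ((f ⊛ h) ⊕ (g ⊛ h)) (suc n) ∎
    where open ≡-Reasoning

  ·-⊛-assoc : ∀ c f g → ((c · f) ⊛ g) ≗ (c · (f ⊛ g))
  ·-⊛-assoc c f g zero = solveℚ 3 (λ a b d → (a ⊠ b) ⊠ d ⊞ conℚ 0ℚ ≔ a ⊠ (b ⊠ d ⊞ conℚ 0ℚ)) refl c (f 0) (g 0)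
  ·-⊛-assoc c f g (suc n) = begin
    ((c · f) ⊛ g) (suc n)                             ≡⟨ ⊛-suc (c · f) g n ⟩
    (c * f 0) * g (suc n) + ((c · shift f) ⊛ g) n     ≡⟨ cong (_+_ ((c * f 0) * g (suc n))) (·-⊛-assoc c (shift f) g n) ⟩
    (c * f 0) * g (suc n) + c * (shift f ⊛ g) n       ≡⟨ solveℚ 4 (λ a b d e → (a ⊠ b) ⊠ d ⊞ a ⊠ e ≔ a ⊠ (b ⊠ d ⊞ e)) refl
                                                           c (f 0) (g (suc n)) ((shift f ⊛ g) n) ⟩
    c * (f 0 * g (suc n) + (shift f ⊛ g) n)           ≡⟨ cong (c *_) (⊛-suc f g n) ⟨
    c * (f ⊛ g) (suc n)                               ∎
    where open ≡-Reasoning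

  shift-⊛ : ∀ f g → shift (f ⊛ g) ≗ ((f 0 · shift g) ⊕ (shift f ⊛ g))
  shift-⊛ = ⊛-suc

  -- Splits off the last summand. Commutativity needs both ends, since exchanging the factors
  -- reverses the sum.
  ⊛-sucʳ : ∀ f g n → (f ⊛ g) (suc n) ≡ (f ⊛ shift g) n + f (suc n) * g 0
  ⊛-sucʳ f g zero = solveℚ 4 (λ a b c d → a ⊠ b ⊞ (c ⊠ d ⊞ conℚ 0ℚ) ≔ (a ⊠ b ⊞ conℚ 0ℚ) ⊞ c ⊠ d) refl (f 0) (g 1) (f 1) (g 0)
  ⊛-sucʳ f g (suc n) = begin
    (f ⊛ g) (suc (suc n))                                                           ≡⟨ ⊛-suc f g (suc n) ⟩
    f 0 * g (suc (suc n)) + (shift f ⊛ g) (suc n)                                   ≡⟨ cong (_+_ (f 0 * g (suc (suc n)))) (⊛-sucʳ (shift f) g n) ⟩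
    f 0 * g (suc (suc n)) + ((shift f ⊛ shift g) n + f (suc (suc n)) * g 0)         ≡⟨ +-assoc (f 0 * g (suc (suc n))) ((shift f ⊛ shift g) n) (f (suc (suc n)) * g 0) ⟨
    (f 0 * g (suc (suc n)) + (shift f ⊛ shift g) n) + f (suc (suc n)) * g 0         ≡⟨ cong (_+ (f (suc (suc n)) * g 0)) (⊛-suc f (shift g) n) ⟨
    (f ⊛ shift g) (suc n) + f (suc (suc n)) * g 0                                   ∎
    where open ≡-Reasoning

  ⊛-comm : ∀ f g → (f ⊛ g) ≗ (g ⊛ f)
  ⊛-comm f g zero = cong (_+ 0ℚ) (*-comm (f 0) (g 0))
  ⊛-comm f g (suc n) = begin
    (f ⊛ g) (suc n)                       ≡⟨ ⊛-suc f g n ⟩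
    f 0 * g (suc n) + (shift f ⊛ g) n     ≡⟨ cong₂ _+_ (*-comm (f 0) (g (suc n))) (⊛-comm (shift f) g n) ⟩
    g (suc n) * f 0 + (g ⊛ shift f) n     ≡⟨ +-comm _ ((g ⊛ shift f) n) ⟩
    (g ⊛ shift f) n + g (suc n) * f 0     ≡⟨ ⊛-sucʳ g f n ⟨
    (g ⊛ f) (suc n)                       ∎
    where open ≡-Reasoning

  ⊛-assoc : ∀ f g h → ((f ⊛ g) ⊛ h) ≗ (f ⊛ (g ⊛ h))
  ⊛-assoc f g h zero = solveℚ 3 (λ a b c → (a ⊠ b ⊞ conℚ 0ℚ) ⊠ c ⊞ conℚ 0ℚ ≔ a ⊠ (b ⊠ c ⊞ conℚ 0ℚ) ⊞ conℚ 0ℚ) refl (f 0) (g 0) (h 0)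
  ⊛-assoc f g h (suc n) = begin
    ((f ⊛ g) ⊛ h) (suc n)
      ≡⟨ ⊛-suc (f ⊛ g) h n ⟩
    (f ⊛ g) 0 * h (suc n) + (shift (f ⊛ g) ⊛ h) n
      ≡⟨ cong₂ _+_ (cong (_* h (suc n)) (+-identityʳ (f 0 * g 0)))
                   (trans (⊛-cong {g = h} (shift-⊛ f g) (λ _ → refl) n) (⊛-distribʳ h (f 0 · shift g) (shift f ⊛ g) n)) ⟩
    f 0 * g 0 * h (suc n) + (((f 0 · shift g) ⊛ h) n + ((shift f ⊛ g) ⊛ h) n)
      ≡⟨ cong (_+_ (f 0 * g 0 * h (suc n))) (cong₂ _+_ (·-⊛-assoc (f 0) (shift g) h n) (⊛-assoc (shift f) g h n)) ⟩
    f 0 * g 0 * h (suc n) + (f 0 * (shift g ⊛ h) n + (shift f ⊛ (g ⊛ h)) n)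
      ≡⟨ solveℚ 5 (λ a b c d e → a ⊠ b ⊠ c ⊞ (a ⊠ d ⊞ e) ≔ a ⊠ (b ⊠ c ⊞ d) ⊞ e) refl
           (f 0) (g 0) (h (suc n)) ((shift g ⊛ h) n) ((shift f ⊛ (g ⊛ h)) n) ⟩
    f 0 * (g 0 * h (suc n) + (shift g ⊛ h) n) + (shift f ⊛ (g ⊛ h)) n
      ≡⟨ cong (λ z → f 0 * z + (shift f ⊛ (g ⊛ h)) n) (⊛-suc g h n) ⟨
    f 0 * (g ⊛ h) (suc n) + (shift f ⊛ (g ⊛ h)) n
      ≡⟨ ⊛-suc f (g ⊛ h) n ⟨
    (f ⊛ (g ⊛ h)) (suc n) ∎
    where open ≡-Reasoning

  ⊛-identityˡ : ∀ f → (C 1ℚ ⊛ f) ≗ f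
  ⊛-identityˡ f n = trans (sym (·-as-⊛ 1ℚ f n)) (*-identityˡ (f n))

  neg : Series → Series
  neg f n = - f n

  seriesRing : CommutativeRing 0ℓ 0ℓ
  seriesRing = record
    { Carrier = Series ; _≈_ = _≗_ ; _+_ = _⊕_ ; _*_ = _⊛_ ; -_ = neg ; 0# = C 0ℚ ; 1# = C 1ℚ
    ; isCommutativeRing = record
      { isRing = record
        { +-isAbelianGroup = record
          { isGroup = record
            { isMonoid = record
              { isSemigroup = record
                { isMagma = record
                  { isEquivalence = record { refl = λ _ → refl ; sym = λ p n → sym (p n) ; trans = λ p r n → trans (p n) (r n) }
                  ; ∙-cong = λ p r n → cong₂ _+_ (p n) (r n) }
                ; assoc = λ f g h n → +-assoc (f n) (g n) (h n) }
              ; identity = (λ f n → trans (cong (_+ f n) (C0 n)) (+-identityˡ (f n)))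
                         , (λ f n → trans (cong (_+_ (f n)) (C0 n)) (+-identityʳ (f n))) }
            ; inverse = (λ f n → trans (+-inverseˡ (f n)) (sym (C0 n)))
                      , (λ f n → trans (+-inverseʳ (f n)) (sym (C0 n)))
            ; ⁻¹-cong = λ p n → cong -_ (p n) }
          ; comm = λ f g n → +-comm (f n) (g n) }
        ; *-cong = ⊛-cong
        ; *-assoc = ⊛-assoc
        ; *-identity = ⊛-identityˡ , (λ f n → trans (⊛-comm f (C 1ℚ) n) (⊛-identityˡ f n))
        ; distrib = (λ h f g n → trans (⊛-comm h (f ⊕ g) n)
                                   (trans (⊛-distribʳ h f g n) (cong₂ _+_ (⊛-comm f h n) (⊛-comm g h n))))
                  , ⊛-distribʳ }
      ; *-comm = ⊛-comm } }
    where
    C0 : ∀ n → C 0ℚ n ≡ 0ℚ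
    C0 zero    = refl
    C0 (suc n) = refl

  seriesACR : AlmostCommutativeRing 0ℓ 0ℓ
  seriesACR = fromCommutativeRing seriesRing

  -- Makes rational numbers available as coefficients, so that normalisation settles series
  -- identities involving ½ and the like.
  constants : CommutativeRing.rawRing +-*-commutativeRing -Raw-AlmostCommutative⟶ seriesACR
  constants = record
    { ⟦_⟧ = C
    ; +-homo = λ a b → λ { zero → refl ; (suc n) → refl }
    ; *-homo = λ a b n → trans (·C a b n) (·-as-⊛ a (C b) n)
    ; -‿homo = λ a → λ { zero → refl ; (suc n) → refl }
    ; 0-homo = λ _ → refl
    ; 1-homo = λ _ → refl }
    where
    ·C : ∀ a b → C (a * b) ≗ (a · C b)
    ·C a b zero    = refl
    ·C a b (suc n) = sym (*-zeroʳ a)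

  constant≟ : ∀ a b → Maybe (C a ≗ C b)
  constant≟ a b with a ≟ℚ b
  ... | yes p = just (λ n → cong (λ c → C c n) p)
  ... | no _  = nothing

  module SeriesSolver =
    RingSolver (CommutativeRing.rawRing +-*-commutativeRing) seriesACR constants constant≟

  open SeriesSolver using (solve; con; _:=_; _:+_; _:*_; _:-_; :-_)

  -- In degree 0, `regular` gives `f 0 ≡ 0ℚ`; what remains of the hypothesis says that `shift f` is
  -- annihilated by `g` as well.
  ⊛-cancelʳ : ∀ g → (∀ c → c * g 0 ≡ 0ℚ → c ≡ 0ℚ) → ∀ f → (∀ n → (f ⊛ g) n ≡ 0ℚ) → ∀ n → f n ≡ 0ℚ
  ⊛-cancelʳ g regular f fg≡0 zero    = regular (f 0) (trans (sym (+-identityʳ _)) (fg≡0 0))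
  ⊛-cancelʳ g regular f fg≡0 (suc n) = ⊛-cancelʳ g regular (shift f) (λ m → begin
    (shift f ⊛ g) m                      ≡⟨ +-identityˡ _ ⟨
    0ℚ + (shift f ⊛ g) m                 ≡⟨ cong (_+ (shift f ⊛ g) m) (trans (cong (_* g (suc m)) f0≡0) (*-zeroˡ (g (suc m)))) ⟨
    f 0 * g (suc m) + (shift f ⊛ g) m    ≡⟨ ⊛-suc f g m ⟨
    (f ⊛ g) (suc m)                      ≡⟨ fg≡0 (suc m) ⟩
    0ℚ                                   ∎) n
    where
    open ≡-Reasoning
    f0≡0 : f 0 ≡ 0ℚ
    f0≡0 = regular (f 0) (trans (sym (+-identityʳ _)) (fg≡0 0))

  open CommutativeRing seriesRing using ()
    renaming (refl to ≗-refl; sym to ≗-sym; trans to ≗-trans; +-cong to ⊕-cong; -‿cong to neg-cong)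

  -- Inverse square roots and the closed forms by elimination.

  poly-∷ : ∀ c cs → poly (c ∷ cs) ≗ (C c ⊕ X ⊛ poly cs)
  poly-∷ c cs zero    = sym (trans (cong (_+_ c) (X⊛-zero (poly cs))) (+-identityʳ c))
  poly-∷ c cs (suc n) = sym (trans (+-identityˡ _) (X⊛-suc (poly cs) n))

  ⊖≗0⇒≗ : ∀ {f g} → (f ⊖ g) ≗ C 0ℚ → f ≗ g
  ⊖≗0⇒≗ {f} {g} p = begin
    f              ≈⟨ solve 2 (λ f g → f := (f :- g) :+ g) ≗-refl f g ⟩
    (f ⊕ neg g) ⊕ g  ≈⟨ ⊕-cong {v = g} p ≗-refl ⟩
    C 0ℚ ⊕ g       ≈⟨ solve 1 (λ g → con 0ℚ :+ g := g) ≗-refl g ⟩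
    g              ∎
    where
    open import Relation.Binary.Reasoning.Setoid (CommutativeRing.setoid seriesRing)

  ≗⇒⊖≗0 : ∀ {f g} → f ≗ g → (f ⊖ g) ≗ C 0ℚ
  ≗⇒⊖≗0 {f} {g} p n = trans (cong (_+ - g n) (p n)) (solve 1 (λ g → g :- g := con 0ℚ) ≗-refl g n)

  ⊛-annihilate : ∀ k {f g} → f ≗ g → (k ⊛ (f ⊖ g)) ≗ C 0ℚ
  ⊛-annihilate k {f} {g} p n = trans (⊛-cong {k} ≗-refl (≗⇒⊖≗0 p) n) (solve 1 (λ k → k :* con 0ℚ := con 0ℚ) ≗-refl k n)

  _⊕₀_ : ∀ {f g} → f ≗ C 0ℚ → g ≗ C 0ℚ → (f ⊕ g) ≗ C 0ℚ
  _⊕₀_ p q n = trans (cong₂ _+_ (p n) (q n)) (solve 0 (con 0ℚ :+ con 0ℚ := con 0ℚ) ≗-refl n)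

  infixl 6 _⊕₀_

  -- The product of `S ⊛ y ⊖ C 1ℚ` and `S ⊛ y ⊕ C 1ℚ` is zero. The second factor has constant term 2
  -- and can be cancelled; the conditions on `S 0` and `y 0` single out this root.
  inverse-of-sqrt : ∀ S y → S 0 ≡ 1ℚ → y 0 ≡ 1ℚ → ((S ⊛ S) ⊛ (y ⊛ y)) ≗ C 1ℚ → (S ⊛ y) ≗ C 1ℚ
  inverse-of-sqrt S y S0≡1 y0≡1 SSyy≗1 = ⊖≗0⇒≗ λ n → trans (⊛-cancelʳ (S ⊛ y ⊕ C 1ℚ) regular (S ⊛ y ⊖ C 1ℚ) product≡0 n) (0≡C0 n)
    where
    0≡C0 : ∀ n → 0ℚ ≡ C 0ℚ n
    0≡C0 zero    = refl
    0≡C0 (suc n) = refl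
    open ≡-Reasoning
    regular : ∀ c → c * ((S 0 * y 0 + 0ℚ) + 1ℚ) ≡ 0ℚ → c ≡ 0ℚ
    regular c 2c≡0 = begin
      c                                          ≡⟨ solveℚ 1 (λ c → c ≔ conℚ ½ ⊠ (c ⊠ ((conℚ 1ℚ ⊠ conℚ 1ℚ ⊞ conℚ 0ℚ) ⊞ conℚ 1ℚ))) refl c ⟩
      ½ * (c * ((1ℚ * 1ℚ + 0ℚ) + 1ℚ))            ≡⟨ cong₂ (λ a b → ½ * (c * ((a * b + 0ℚ) + 1ℚ))) S0≡1 y0≡1 ⟨
      ½ * (c * ((S 0 * y 0 + 0ℚ) + 1ℚ))          ≡⟨ cong (½ *_) 2c≡0 ⟩
      ½ * 0ℚ                                     ≡⟨ *-zeroʳ ½ ⟩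
      0ℚ                                         ∎
    product≡0 : ∀ n → ((S ⊛ y ⊖ C 1ℚ) ⊛ (S ⊛ y ⊕ C 1ℚ)) n ≡ 0ℚ
    product≡0 n = begin
      ((S ⊛ y ⊖ C 1ℚ) ⊛ (S ⊛ y ⊕ C 1ℚ)) n
        ≡⟨ solve 2 (λ S y → (S :* y :- con 1ℚ) :* (S :* y :+ con 1ℚ) := (S :* S) :* (y :* y) :- con 1ℚ) ≗-refl S y n ⟩
      (((S ⊛ S) ⊛ (y ⊛ y)) ⊖ C 1ℚ) n
        ≡⟨ ≗⇒⊖≗0 SSyy≗1 n ⟩
      C 0ℚ n
        ≡⟨ 0≡C0 n ⟨
      0ℚ ∎

  poly-2 : ∀ a b → poly (a ∷ b ∷ []) ≗ (C a ⊕ X ⊛ C b)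
  poly-2 a b = poly-∷ a (b ∷ [])

  poly-3 : ∀ a b c → poly (a ∷ b ∷ c ∷ []) ≗ (C a ⊕ X ⊛ (C b ⊕ X ⊛ C c))
  poly-3 a b c = ≗-trans (poly-∷ a _) (⊕-cong {x = C a} ≗-refl (⊛-cong {X} ≗-refl (poly-2 b c)))

  poly-4 : ∀ a b c d → poly (a ∷ b ∷ c ∷ d ∷ []) ≗ (C a ⊕ X ⊛ (C b ⊕ X ⊛ (C c ⊕ X ⊛ C d)))
  poly-4 a b c d = ≗-trans (poly-∷ a _) (⊕-cong {x = C a} ≗-refl (⊛-cong {X} ≗-refl (poly-3 b c d)))

  ·-resp-≗ : ∀ c {f g} → f ≗ g → (c · f) ≗ (C c ⊛ g)
  ·-resp-≗ c {f} p = ≗-trans (·-as-⊛ c f) (⊛-cong {C c} ≗-refl p)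

  constant-term : ∀ f → (C 1ℚ ⊖ C (q 2) ⊛ (X ⊛ f)) 0 ≡ 1ℚ
  constant-term f = cong (λ z → 1ℚ + - (q 2 * z + 0ℚ)) (X⊛-zero f)

  -- In the proofs below the difference of the two sides is written as a combination of the differences
  -- of the hypotheses; the coefficients come from eliminating the unknown series.
  module UnsignedClosedForm (A B S : Series)
    (A-eq : A ≗ (C 1ℚ ⊕ X ⊛ (A ⊛ A)))
    (B-eq : B ≗ (X ⊛ ((B ⊛ A) ⊕ (A ⊛ B)) ⊕ X ⊛ (X ⊛ ((A ⊖ C 1ℚ) ⊛ A))))
    (S-inv : IsInvSqrt1-4x S)
    where
    y : Series
    y = C 1ℚ ⊖ C (q 2) ⊛ (X ⊛ A)

    y² : (y ⊛ y) ≗ poly (1ℚ ∷ - q 4 ∷ [])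
    y² = ≗-trans (⊖≗0⇒≗ (≗-trans
      (solve 2 (λ X A → (con 1ℚ :- con (q 2) :* (X :* A)) :* (con 1ℚ :- con (q 2) :* (X :* A)) :- (con 1ℚ :+ X :* con (- q 4))
          := (con (- q 4) :* X) :* (A :- (con 1ℚ :+ X :* (A :* A)))) ≗-refl X A)
      (⊛-annihilate (C (- q 4) ⊛ X) A-eq))) (≗-sym (poly-2 1ℚ (- q 4)))

    Sy≗1 : (S ⊛ y) ≗ C 1ℚ
    Sy≗1 = inverse-of-sqrt S y (proj₁ S-inv) (constant-term A)
             (≗-trans (⊛-cong {S ⊛ S} ≗-refl y²) (proj₂ S-inv))

    -- The equation for `B` reads B y = X²(A² - A). With X A² = A - 1 and X A = (1 - y)/2 its right
    -- side becomes ½(1 - 3X) - ½(1 - X) y; multiplying by `S` and using S y = 1 gives the claim.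
    B-closed : B ≗ (½ · poly (- 1ℚ ∷ 1ℚ ∷ []) ⊕ ½ · (poly (1ℚ ∷ - q 3 ∷ []) ⊛ S))
    B-closed = ≗-trans
      (⊖≗0⇒≗ (≗-trans
        (solve 4 (λ X A B S →
            B :- (con ½ :* (con (- 1ℚ) :+ X :* con 1ℚ) :+ con ½ :* ((con 1ℚ :+ X :* con (- q 3)) :* S))
            := (:- (S :* X)) :* (A :- (con 1ℚ :+ X :* (A :* A)))
               :+ S :* (B :- (X :* (B :* A :+ A :* B) :+ X :* (X :* ((A :- con 1ℚ) :* A))))
               :+ (con ½ :* (X :- con 1ℚ) :- B) :* (S :* (con 1ℚ :- con (q 2) :* (X :* A)) :- con 1ℚ))
          ≗-refl X A B S)
        (⊛-annihilate (neg (S ⊛ X)) A-eq ⊕₀ ⊛-annihilate S B-eq ⊕₀ ⊛-annihilate (C ½ ⊛ (X ⊖ C 1ℚ) ⊖ B) Sy≗1)))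
      (≗-sym (⊕-cong (·-resp-≗ ½ (poly-2 (- 1ℚ) 1ℚ))
                     (·-resp-≗ ½ (⊛-cong {g = S} (poly-2 1ℚ (- q 3)) ≗-refl))))

  -- `D⁻` and `G⁻` stand for D(-x) and G(-x), and their equations are the images of the other two
  -- under x ↦ -x. `O` is the odd part of `D`; `P` and `Q` are the even and odd parts of `G`.
  module SignedClosedForm (D D⁻ G G⁻ T : Series)
    (D-eq : D ≗ (C 1ℚ ⊕ X ⊛ (C ½ ⊛ (D ⊛ D ⊕ D⁻ ⊛ D⁻))))
    (D⁻-eq : D⁻ ≗ (C 1ℚ ⊕ neg X ⊛ (C ½ ⊛ (D ⊛ D ⊕ D⁻ ⊛ D⁻))))
    (G-eq : G ≗ (X ⊛ (G ⊛ D ⊕ G⁻ ⊛ D⁻) ⊕ X ⊛ (X ⊛ (C (- ½) ⊛ (D ⊛ D ⊕ D⁻ ⊛ D⁻ ⊖ C (q 2) ⊛ D⁻)))))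
    (G⁻-eq : G⁻ ≗ (neg X ⊛ (G ⊛ D ⊕ G⁻ ⊛ D⁻) ⊕ X ⊛ (X ⊛ (C (- ½) ⊛ (D ⊛ D ⊕ D⁻ ⊛ D⁻ ⊖ C (q 2) ⊛ D)))))
    (T-inv : IsInvSqrt1-4x² T)
    where
    O P Q y : Series
    O = C ½ ⊛ (D ⊖ D⁻)
    P = C ½ ⊛ (G ⊕ G⁻)
    Q = C ½ ⊛ (G ⊖ G⁻)
    y = C 1ℚ ⊖ C (q 2) ⊛ (X ⊛ O)

    -- The terms with `X` and with `neg X` cancel in the sum of the two equations.
    D+D⁻≗2 : (D ⊕ D⁻) ≗ C (q 2)
    D+D⁻≗2 = ⊖≗0⇒≗ (≗-trans
      (solve 3 (λ X D D⁻ → (D :+ D⁻) :- con (q 2)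
          := con 1ℚ :* (D :- (con 1ℚ :+ X :* (con ½ :* (D :* D :+ D⁻ :* D⁻))))
             :+ con 1ℚ :* (D⁻ :- (con 1ℚ :+ (:- X) :* (con ½ :* (D :* D :+ D⁻ :* D⁻))))) ≗-refl X D D⁻)
      (⊛-annihilate (C 1ℚ) D-eq ⊕₀ ⊛-annihilate (C 1ℚ) D⁻-eq))

    O-eq : O ≗ (X ⊛ (C 1ℚ ⊕ O ⊛ O))
    O-eq = ⊖≗0⇒≗ (≗-trans
      (solve 3 (λ X D D⁻ → let O = con ½ :* (D :- D⁻) in O :- X :* (con 1ℚ :+ O :* O)
          := con ½ :* (D :- (con 1ℚ :+ X :* (con ½ :* (D :* D :+ D⁻ :* D⁻))))
             :+ con (- ½) :* (D⁻ :- (con 1ℚ :+ (:- X) :* (con ½ :* (D :* D :+ D⁻ :* D⁻))))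
             -- With s = D + D⁻ one has ½(D² + D⁻²) - O² = s²/4, and s²/4 - 1 = ¼(s + 2)(s - 2).
             :+ (con (+ 1 / 4) :* X :* (D :+ D⁻ :+ con (q 2))) :* ((D :+ D⁻) :- con (q 2))) ≗-refl X D D⁻)
      (⊛-annihilate (C ½) D-eq ⊕₀ ⊛-annihilate (C (- ½)) D⁻-eq
        ⊕₀ ⊛-annihilate (C (+ 1 / 4) ⊛ X ⊛ (D ⊕ D⁻ ⊕ C (q 2))) D+D⁻≗2))

    y² : (y ⊛ y) ≗ poly (1ℚ ∷ 0ℚ ∷ - q 4 ∷ [])
    y² = ≗-trans (⊖≗0⇒≗ (≗-trans
      (solve 2 (λ X O → (con 1ℚ :- con (q 2) :* (X :* O)) :* (con 1ℚ :- con (q 2) :* (X :* O))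
            :- (con 1ℚ :+ X :* (con 0ℚ :+ X :* con (- q 4)))
          := (con (- q 4) :* X) :* (O :- X :* (con 1ℚ :+ O :* O))) ≗-refl X O)
      (⊛-annihilate (C (- q 4) ⊛ X) O-eq))) (≗-sym (poly-3 1ℚ 0ℚ (- q 4)))

    Ty≗1 : (T ⊛ y) ≗ C 1ℚ
    Ty≗1 = inverse-of-sqrt T y (proj₁ T-inv) (constant-term O)
             (≗-trans (⊛-cong {T ⊛ T} ≗-refl y²) (proj₂ T-inv))

    -- In the even part of `G` the summands X(G D + G⁻ D⁻) cancel. There remains -½X²(D² + D⁻² - D -
    -- D⁻), and D = 1 + O, D⁻ = 1 - O.
    P-eq : P ≗ neg ((X ⊛ O) ⊛ (X ⊛ O))
    P-eq = ⊖≗0⇒≗ (≗-trans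
      (solve 5 (λ X D D⁻ G G⁻ → let O = con ½ :* (D :- D⁻) in
          con ½ :* (G :+ G⁻) :- (:- ((X :* O) :* (X :* O)))
          := con ½ :* (G :- (X :* (G :* D :+ G⁻ :* D⁻) :+ X :* (X :* (con (- ½) :* (D :* D :+ D⁻ :* D⁻ :- con (q 2) :* D⁻)))))
             :+ con ½ :* (G⁻ :- ((:- X) :* (G :* D :+ G⁻ :* D⁻) :+ X :* (X :* (con (- ½) :* (D :* D :+ D⁻ :* D⁻ :- con (q 2) :* D)))))
             :+ (con (- (+ 1 / 4)) :* (X :* X) :* (D :+ D⁻)) :* ((D :+ D⁻) :- con (q 2))) ≗-refl X D D⁻ G G⁻)
      (⊛-annihilate (C ½) G-eq ⊕₀ ⊛-annihilate (C ½) G⁻-eq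
        ⊕₀ ⊛-annihilate (C (- (+ 1 / 4)) ⊛ (X ⊛ X) ⊛ (D ⊕ D⁻)) D+D⁻≗2))

    -- Here G D + G⁻ D⁻ = 2(P + Q O), since the even part of `D` is 1; the term -X² O is the odd
    -- part of the crossed contribution -X²(O² + O).
    Q-eq : Q ≗ (C (q 2) ⊛ X ⊛ (Q ⊛ O ⊕ P) ⊖ X ⊛ X ⊛ O)
    Q-eq = ⊖≗0⇒≗ (≗-trans
      (solve 5 (λ X D D⁻ G G⁻ → let O = con ½ :* (D :- D⁻) ; P = con ½ :* (G :+ G⁻) ; Q = con ½ :* (G :- G⁻) in
          Q :- (con (q 2) :* X :* (Q :* O :+ P) :- X :* X :* O)
          := con ½ :* (G :- (X :* (G :* D :+ G⁻ :* D⁻) :+ X :* (X :* (con (- ½) :* (D :* D :+ D⁻ :* D⁻ :- con (q 2) :* D⁻)))))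
             :+ con (- ½) :* (G⁻ :- ((:- X) :* (G :* D :+ G⁻ :* D⁻) :+ X :* (X :* (con (- ½) :* (D :* D :+ D⁻ :* D⁻ :- con (q 2) :* D)))))
             :+ (X :* P) :* ((D :+ D⁻) :- con (q 2))) ≗-refl X D D⁻ G G⁻)
      (⊛-annihilate (C ½) G-eq ⊕₀ ⊛-annihilate (C (- ½)) G⁻-eq
        ⊕₀ ⊛-annihilate (X ⊛ P) D+D⁻≗2))

    -- By `Q-eq`, Q y = 2 X P - X² O, so (P + Q) y = P(y + 2X) - X² O. Substituting P = -(X O)², X O
    -- = (1 - y)/2 and y² = 1 - 4X² makes the right side linear in y, namely p y + ½ r with the p
    -- and r below; multiplying by `T` turns it into p + ½ r T.
    G-closed : G ≗ (((- ½) · poly (1ℚ ∷ - q 3 ∷ - q 2 ∷ [])) ⊕ (½ · (poly (1ℚ ∷ - q 3 ∷ - q 4 ∷ q 4 ∷ []) ⊛ T)))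
    G-closed = ≗-trans
      (solve 2 (λ G G⁻ → G := con ½ :* (G :+ G⁻) :+ con ½ :* (G :- G⁻)) ≗-refl G G⁻)
      (≗-trans
      (⊖≗0⇒≗ (≗-trans
        (solve 5 (λ X O P Q T →
            let p = con (- ½) :* (con 1ℚ :+ X :* (con (- q 3) :+ X :* con (- q 2)))
                r = con 1ℚ :+ X :* (con (- q 3) :+ X :* (con (- q 4) :+ X :* con (q 4)))
                y = con 1ℚ :- con (q 2) :* (X :* O) in
            (P :+ Q) :- (p :+ con ½ :* (r :* T))
            := (T :* (y :+ con (q 2) :* X)) :* (P :- (:- ((X :* O) :* (X :* O))))
               :+ T :* (Q :- (con (q 2) :* X :* (Q :* O :+ P) :- X :* X :* O))
               :+ (p :- P :- Q) :* (T :* y :- con 1ℚ)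
               :+ (:- (T :* (con (q 2) :* X :* X :* O :+ X :- con (q 2) :* X :* X))) :* (O :- X :* (con 1ℚ :+ O :* O)))
          ≗-refl X O P Q T)
        (⊛-annihilate (T ⊛ (y ⊕ C (q 2) ⊛ X)) P-eq ⊕₀ ⊛-annihilate T Q-eq
          ⊕₀ ⊛-annihilate (C (- ½) ⊛ (C 1ℚ ⊕ X ⊛ (C (- q 3) ⊕ X ⊛ C (- q 2))) ⊖ P ⊖ Q) Ty≗1
          ⊕₀ ⊛-annihilate (neg (T ⊛ (C (q 2) ⊛ X ⊛ X ⊛ O ⊕ X ⊖ C (q 2) ⊛ X ⊛ X))) O-eq)))
      (≗-sym (⊕-cong (·-resp-≗ (- ½) (poly-3 1ℚ (- q 3) (- q 2)))
                     (·-resp-≗ ½ (⊛-cong {g = T} (poly-4 1ℚ (- q 3) (- q 4) (q 4)) ≗-refl)))))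

  -- Weighted Cauchy products, signs and the substitution x ↦ -x.

  Σ : {A : Set} → (A → ℚ) → List A → ℚ
  Σ f xs = foldr _+_ 0ℚ (map f xs)

  Σ-cong : ∀ {A : Set} {f g : A → ℚ} → (∀ x → f x ≡ g x) → ∀ xs → Σ f xs ≡ Σ g xs
  Σ-cong p []       = refl
  Σ-cong p (x ∷ xs) = cong₂ _+_ (p x) (Σ-cong p xs)

  Σ-+ : ∀ {A : Set} (f g : A → ℚ) xs → Σ (λ x → f x + g x) xs ≡ Σ f xs + Σ g xs
  Σ-+ f g []       = refl
  Σ-+ f g (x ∷ xs) = trans (cong (_+_ (f x + g x)) (Σ-+ f g xs))
    (solveℚ 4 (λ a b c d → (a ⊞ b) ⊞ (c ⊞ d) ≔ (a ⊞ c) ⊞ (b ⊞ d)) refl (f x) (g x) (Σ f xs) (Σ g xs))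

  Σ-* : ∀ {A : Set} c (f : A → ℚ) xs → Σ (λ x → c * f x) xs ≡ c * Σ f xs
  Σ-* c f []       = sym (*-zeroʳ c)
  Σ-* c f (x ∷ xs) = trans (cong (_+_ (c * f x)) (Σ-* c f xs)) (sym (*-distribˡ-+ c (f x) (Σ f xs)))

  -- A Cauchy product with an extra factor depending on both degrees: it will carry the weight of
  -- the inversions between two parts of given lengths.
  conv : (ℕ → ℕ → ℚ) → Series → Series → Series
  conv κ f g n = Σ (λ k → κ k (n ∸ k) * (f k * g (n ∸ k))) (upTo (suc n))

  conv-cong : ∀ {κ f g κ′ f′ g′} → (∀ j k → κ j k * (f j * g k) ≡ κ′ j k * (f′ j * g′ k)) → conv κ f g ≗ conv κ′ f′ g′
  conv-cong p n = Σ-cong (λ k → p k (n ∸ k)) (upTo (suc n))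

  conv-1 : ∀ f g → conv (λ _ _ → 1ℚ) f g ≗ (f ⊛ g)
  conv-1 f g n = Σ-cong (λ k → *-identityˡ (f k * g (n ∸ k))) (upTo (suc n))

  alt : ℕ → ℚ
  alt zero    = 1ℚ
  alt (suc n) = - alt n


  alt-+ : ∀ m n → alt (m ℕ.+ n) ≡ alt m * alt n
  alt-+ zero    n = sym (*-identityˡ (alt n))
  alt-+ (suc m) n = trans (cong -_ (alt-+ m n)) (neg-distribˡ-* (alt m) (alt n))

  alt² : ∀ n → alt n * alt n ≡ 1ℚ
  alt² zero    = refl
  alt² (suc n) = trans (solveℚ 1 (λ a → (⊟ a) ⊠ (⊟ a) ≔ a ⊠ a) refl (alt n)) (alt² n)

  -- The sign is 1 for even `j` and `alt k` for odd `j`; (1 + alt j)/2 and (1 - alt j)/2 are the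
  -- indicators of the two cases. This makes it a sum of products of a function of `j` and a
  -- function of `k`.
  alt-* : ∀ j k → alt (j ℕ.* k) ≡ ½ * ((1ℚ + alt j) + (1ℚ + - alt j) * alt k)
  alt-* zero    k = solveℚ 1 (λ b → conℚ 1ℚ ≔ conℚ ½ ⊠ ((conℚ 1ℚ ⊞ conℚ 1ℚ) ⊞ (conℚ 1ℚ ⊞ ⊟ conℚ 1ℚ) ⊠ b)) refl (alt k)
  alt-* (suc j) k = begin
    alt (k ℕ.+ j ℕ.* k)
      ≡⟨ trans (alt-+ k (j ℕ.* k)) (cong (alt k *_) (alt-* j k)) ⟩
    alt k * (½ * ((1ℚ + alt j) + (1ℚ + - alt j) * alt k))
      ≡⟨ solveℚ 2 (λ a b → b ⊠ (conℚ ½ ⊠ ((conℚ 1ℚ ⊞ a) ⊞ (conℚ 1ℚ ⊟ a) ⊠ b)) ≔ conℚ ½ ⊠ ((conℚ 1ℚ ⊟ a) ⊠ (b ⊠ b) ⊞ (conℚ 1ℚ ⊟ ⊟ a) ⊠ b)) refl (alt j) (alt k) ⟩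
    ½ * ((1ℚ + - alt j) * (alt k * alt k) + (1ℚ + - - alt j) * alt k)
      ≡⟨ cong (λ z → ½ * (z + (1ℚ + - - alt j) * alt k)) (trans (cong ((1ℚ + - alt j) *_) (alt² k)) (*-identityʳ (1ℚ + - alt j))) ⟩
    ½ * ((1ℚ + - alt j) + (1ℚ + - - alt j) * alt k) ∎
    where open ≡-Reasoning

  -- The substitution x ↦ -x, an involutive ring automorphism.
  σ : Series → Series
  σ f n = alt n * f n

  σ-cong : ∀ {f g} → f ≗ g → σ f ≗ σ g
  σ-cong p n = cong (alt n *_) (p n)

  σ-involutive : ∀ f → σ (σ f) ≗ f
  σ-involutive f n = trans (sym (*-assoc (alt n) (alt n) (f n))) (trans (cong (_* f n) (alt² n)) (*-identityˡ (f n)))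

  σ-⊕ : ∀ f g → σ (f ⊕ g) ≗ (σ f ⊕ σ g)
  σ-⊕ f g n = *-distribˡ-+ (alt n) (f n) (g n)

  σ-C : ∀ c → σ (C c) ≗ C c
  σ-C c zero    = *-identityˡ c
  σ-C c (suc n) = *-zeroʳ (alt (suc n))

  σ-X : σ X ≗ neg X
  σ-X zero          = refl
  σ-X (suc zero)    = refl
  σ-X (suc (suc n)) = *-zeroʳ (alt (suc (suc n)))

  σ-⊛ : ∀ f g → σ (f ⊛ g) ≗ (σ f ⊛ σ g)
  σ-⊛ f g zero = solveℚ 2 (λ a b → conℚ 1ℚ ⊠ (a ⊠ b ⊞ conℚ 0ℚ) ≔ (conℚ 1ℚ ⊠ a) ⊠ (conℚ 1ℚ ⊠ b) ⊞ conℚ 0ℚ) refl (f 0) (g 0)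
  σ-⊛ f g (suc n) = begin
    - alt n * (f ⊛ g) (suc n)
      ≡⟨ cong (- alt n *_) (⊛-suc f g n) ⟩
    - alt n * (f 0 * g (suc n) + (shift f ⊛ g) n)
      ≡⟨ solveℚ 4 (λ a b c d → (⊟ a) ⊠ (b ⊠ c ⊞ d) ≔ (conℚ 1ℚ ⊠ b) ⊠ ((⊟ a) ⊠ c) ⊞ conℚ (- 1ℚ) ⊠ (a ⊠ d)) refl
           (alt n) (f 0) (g (suc n)) ((shift f ⊛ g) n) ⟩
    (1ℚ * f 0) * (- alt n * g (suc n)) + (- 1ℚ) * (alt n * (shift f ⊛ g) n)
      ≡⟨ cong (λ z → (1ℚ * f 0) * (- alt n * g (suc n)) + (- 1ℚ) * z) (σ-⊛ (shift f) g n) ⟩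
    σ f 0 * σ g (suc n) + (- 1ℚ) * (σ (shift f) ⊛ σ g) n
      ≡⟨ cong (_+_ (σ f 0 * σ g (suc n))) (trans (sym (·-⊛-assoc (- 1ℚ) (σ (shift f)) (σ g) n)) (⊛-cong {g = σ g} shift-σ ≗-refl n)) ⟩
    σ f 0 * σ g (suc n) + (shift (σ f) ⊛ σ g) n
      ≡⟨ ⊛-suc (σ f) (σ g) n ⟨
    (σ f ⊛ σ g) (suc n) ∎
    where
    open ≡-Reasoning
    shift-σ : ((- 1ℚ) · σ (shift f)) ≗ shift (σ f)
    shift-σ k = solveℚ 2 (λ a b → conℚ (- 1ℚ) ⊠ (a ⊠ b) ≔ (⊟ a) ⊠ b) refl (alt k) (f (suc k))

  -- For odd `j` the number `suc j` is even and the sign disappears: the odd part of `f` is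
  -- multiplied by g(x), the even part by g(-x).
  twist : Series → Series → Series
  twist f g = C ½ ⊛ ((f ⊖ σ f) ⊛ g ⊕ (f ⊕ σ f) ⊛ σ g)

  conv-alt : ∀ f g → conv (λ j k → alt (suc j ℕ.* k)) f g ≗ twist f g
  conv-alt f g n = begin
    Σ (λ k → alt (suc k ℕ.* (n ∸ k)) * (f k * g (n ∸ k))) (upTo (suc n))
      ≡⟨ Σ-cong (λ k → trans (cong (_* (f k * g (n ∸ k))) (alt-* (suc k) (n ∸ k)))
           (solveℚ 4 (λ a b c d → (conℚ ½ ⊠ ((conℚ 1ℚ ⊞ ⊟ a) ⊞ (conℚ 1ℚ ⊞ ⊟ ⊟ a) ⊠ b)) ⊠ (c ⊠ d)
               ≔ conℚ ½ ⊠ ((c ⊟ a ⊠ c) ⊠ d ⊞ (c ⊞ a ⊠ c) ⊠ (b ⊠ d))) refl (alt k) (alt (n ∸ k)) (f k) (g (n ∸ k))))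
           (upTo (suc n)) ⟩
    Σ (λ k → ½ * ((f ⊖ σ f) k * g (n ∸ k) + (f ⊕ σ f) k * σ g (n ∸ k))) (upTo (suc n))
      ≡⟨ Σ-* ½ (λ k → p k + r k) (upTo (suc n)) ⟩
    ½ * Σ (λ k → (f ⊖ σ f) k * g (n ∸ k) + (f ⊕ σ f) k * σ g (n ∸ k)) (upTo (suc n))
      ≡⟨ cong (½ *_) (Σ-+ p r (upTo (suc n))) ⟩
    ½ * (((f ⊖ σ f) ⊛ g) n + ((f ⊕ σ f) ⊛ σ g) n)
      ≡⟨ ·-as-⊛ ½ ((f ⊖ σ f) ⊛ g ⊕ (f ⊕ σ f) ⊛ σ g) n ⟩
    twist f g n ∎
    where
    open ≡-Reasoning
    p r : ℕ → ℚ
    p k = (f ⊖ σ f) k * g (n ∸ k)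
    r k = (f ⊕ σ f) k * σ g (n ∸ k)

  -- From recurrences to functional equations.

  unfold : ∀ {f g} c → f 0 ≡ c → (∀ n → f (suc n) ≡ g n) → f ≗ (C c ⊕ X ⊛ g)
  unfold {g = g} c p r zero    = trans p (sym (trans (cong (_+_ c) (X⊛-zero g)) (+-identityʳ c)))
  unfold {g = g} c p r (suc n) = trans (r n) (sym (trans (+-identityˡ _) (X⊛-suc g n)))

  -- A and B count the avoiders and the permutations with one occurrence, weighted by a character χ of
  -- the inversion number. The argument of χ is the number of inversions between different parts of a
  -- piece; in crossed-suc, A ⊖ C 1ℚ is there because the part after the maximum is nonempty.
  record Recurrence (χ : ℕ → ℚ) (A B : Series) : Set where
    field
      crossed      : Series
      A-zero       : A 0 ≡ 1ℚ
      A-suc        : ∀ n → A (suc n) ≡ conv (λ j k → χ (suc j ℕ.* k)) A A n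
      B-zero       : B 0 ≡ 0ℚ
      B-suc        : ∀ n → B (suc n) ≡ conv (λ j k → χ (suc j ℕ.* k)) B A n
                                       + conv (λ j k → χ (suc j ℕ.* k)) A B n
                                       + crossed n
      crossed-zero : crossed 0 ≡ 0ℚ
      crossed-suc  : ∀ n → crossed (suc n) ≡ conv (λ k i → χ (i ℕ.* suc k ℕ.+ (ℕ.pred k ℕ.+ k))) (A ⊖ C 1ℚ) A n

    expand : ∀ {U V W} →
      conv (λ j k → χ (suc j ℕ.* k)) A A ≗ U →
      (conv (λ j k → χ (suc j ℕ.* k)) B A ⊕ conv (λ j k → χ (suc j ℕ.* k)) A B) ≗ V →
      conv (λ k i → χ (i ℕ.* suc k ℕ.+ (ℕ.pred k ℕ.+ k))) (A ⊖ C 1ℚ) A ≗ W →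
      A ≗ (C 1ℚ ⊕ X ⊛ U) × B ≗ (X ⊛ V ⊕ X ⊛ (X ⊛ W))
    expand {U} {V} {W} AA BA AA₊ =
      unfold 1ℚ A-zero (λ n → trans (A-suc n) (AA n)) ,
      ≗-trans (unfold 0ℚ B-zero (λ n → trans (B-suc n) (cong₂ _+_ (BA n)
        (unfold {crossed} 0ℚ crossed-zero (λ m → trans (crossed-suc m) (AA₊ m)) n))))
        (solve 3 (λ X V W → con 0ℚ :+ X :* (V :+ (con 0ℚ :+ X :* W)) := X :* V :+ X :* (X :* W)) ≗-refl X V W)

  module _ {A B : Series} (rec : Recurrence (λ _ → 1ℚ) A B) {S : Series} (S-inv : IsInvSqrt1-4x S) where
    open Recurrence rec

    unsigned-closed : B ≗ (½ · poly (- 1ℚ ∷ 1ℚ ∷ []) ⊕ ½ · (poly (1ℚ ∷ - q 3 ∷ []) ⊛ S))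
    unsigned-closed = UnsignedClosedForm.B-closed A B S (proj₁ eqs) (proj₂ eqs) S-inv
      where
      eqs = expand (conv-1 A A) (⊕-cong (conv-1 B A) (conv-1 A B)) (conv-1 (A ⊖ C 1ℚ) A)

  module _ {D G : Series} (rec : Recurrence alt D G) {T : Series} (T-inv : IsInvSqrt1-4x² T) where
    open Recurrence rec

    private
      D² : Series
      D² = D ⊛ D ⊕ σ D ⊛ σ D

      DD : conv (λ j k → alt (suc j ℕ.* k)) D D ≗ (C ½ ⊛ D²)
      DD = ≗-trans (conv-alt D D) (solve 2 (λ D D⁻ → con ½ :* ((D :- D⁻) :* D :+ (D :+ D⁻) :* D⁻) := con ½ :* (D :* D :+ D⁻ :* D⁻)) ≗-refl D (σ D))

      GD : (conv (λ j k → alt (suc j ℕ.* k)) G D ⊕ conv (λ j k → alt (suc j ℕ.* k)) D G) ≗ (G ⊛ D ⊕ σ G ⊛ σ D)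
      GD = ≗-trans (⊕-cong (conv-alt G D) (conv-alt D G))
        (solve 4 (λ D D⁻ G G⁻ → con ½ :* ((G :- G⁻) :* D :+ (G :+ G⁻) :* D⁻) :+ con ½ :* ((D :- D⁻) :* G :+ (D :+ D⁻) :* G⁻)
            := G :* D :+ G⁻ :* D⁻) ≗-refl D (σ D) G (σ G))

      -- The right part has length `suc k` here. The numbers `k` and `suc k` have an odd sum, which
      -- produces the minus sign; the rest has the exponent of `conv-alt` with the right part in the
      -- place of `j`.
      alt-crossed : ∀ k i → alt (i ℕ.* suc (suc k) ℕ.+ (k ℕ.+ suc k)) ≡ - alt (suc (suc k) ℕ.* i)
      alt-crossed k i = begin
        alt (i ℕ.* suc (suc k) ℕ.+ (k ℕ.+ suc k))
          ≡⟨ alt-+ (i ℕ.* suc (suc k)) (k ℕ.+ suc k) ⟩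
        alt (i ℕ.* suc (suc k)) * alt (k ℕ.+ suc k)
          ≡⟨ cong₂ (λ a b → alt a * b) (ℕₚ.*-comm i (suc (suc k))) (alt-+ k (suc k)) ⟩
        alt (suc (suc k) ℕ.* i) * (alt k * - alt k)
          ≡⟨ solveℚ 2 (λ a b → a ⊠ (b ⊠ (⊟ b)) ≔ ⊟ (a ⊠ (b ⊠ b))) refl (alt (suc (suc k) ℕ.* i)) (alt k) ⟩
        - (alt (suc (suc k) ℕ.* i) * (alt k * alt k))
          ≡⟨ cong -_ (trans (cong (alt (suc (suc k) ℕ.* i) *_) (alt² k)) (*-identityʳ _)) ⟩
        - alt (suc (suc k) ℕ.* i) ∎
        where open ≡-Reasoning

      -- The minus sign of `alt-crossed` is absorbed into `C 1ℚ ⊖ D`. For an empty right part `pred`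
      -- truncates and the two signs agree instead of being opposite, but there both sides vanish
      -- because `D 0` is 1.
      term : ∀ k i → alt (i ℕ.* suc k ℕ.+ (ℕ.pred k ℕ.+ k)) * ((D ⊖ C 1ℚ) k * D i) ≡ alt (suc k ℕ.* i) * (((C 1ℚ ⊖ D) k) * D i)
      term zero i = begin
        a * ((D 0 + - 1ℚ) * D i)   ≡⟨ cong (λ d → a * ((d + - 1ℚ) * D i)) A-zero ⟩
        a * ((1ℚ + - 1ℚ) * D i)    ≡⟨ solveℚ 3 (λ a b d → a ⊠ ((conℚ 1ℚ ⊟ conℚ 1ℚ) ⊠ d) ≔ b ⊠ ((conℚ 1ℚ ⊟ conℚ 1ℚ) ⊠ d)) refl a b (D i) ⟩
        b * ((1ℚ + - 1ℚ) * D i)    ≡⟨ cong (λ d → b * ((1ℚ + - d) * D i)) A-zero ⟨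
        b * ((1ℚ + - D 0) * D i)   ∎
        where
        open ≡-Reasoning
        a b : ℚ
        a = alt (i ℕ.* 1 ℕ.+ 0)
        b = alt (1 ℕ.* i)
      term (suc k) i = trans (cong (_* ((D ⊖ C 1ℚ) (suc k) * D i)) (alt-crossed k i))
        (solveℚ 4 (λ a d e c → (⊟ a) ⊠ ((d ⊟ c) ⊠ e) ≔ a ⊠ ((c ⊟ d) ⊠ e)) refl (alt (suc (suc k) ℕ.* i)) (D (suc k)) (D i) (C 1ℚ (suc k)))

      σ-1-D : σ (C 1ℚ ⊖ D) ≗ (C 1ℚ ⊖ σ D)
      σ-1-D n = trans (solveℚ 3 (λ a c d → a ⊠ (c ⊟ d) ≔ a ⊠ c ⊟ a ⊠ d) refl (alt n) (C 1ℚ n) (D n)) (cong (_+ - σ D n) (σ-C 1ℚ n))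

      D₊D : conv (λ k i → alt (i ℕ.* suc k ℕ.+ (ℕ.pred k ℕ.+ k))) (D ⊖ C 1ℚ) D
              ≗ (C (- ½) ⊛ (D² ⊖ C (q 2) ⊛ σ D))
      D₊D = ≗-trans (conv-cong {λ k i → alt (i ℕ.* suc k ℕ.+ (ℕ.pred k ℕ.+ k))} {D ⊖ C 1ℚ} {D} {λ k i → alt (suc k ℕ.* i)} {C 1ℚ ⊖ D} {D} term)
        (≗-trans (conv-alt (C 1ℚ ⊖ D) D)
        (≗-trans (⊛-cong {C ½} ≗-refl (⊕-cong (⊛-cong {g = D} (⊕-cong {x = C 1ℚ ⊖ D} ≗-refl (neg-cong σ-1-D)) ≗-refl)
                                              (⊛-cong {g = σ D} (⊕-cong {x = C 1ℚ ⊖ D} ≗-refl σ-1-D) ≗-refl)))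
        (solve 2 (λ D D⁻ → con ½ :* (((con 1ℚ :- D) :- (con 1ℚ :- D⁻)) :* D :+ ((con 1ℚ :- D) :+ (con 1ℚ :- D⁻)) :* D⁻)
            := con (- ½) :* ((D :* D :+ D⁻ :* D⁻) :- con (q 2) :* D⁻)) ≗-refl D (σ D))))

      eqs = expand DD GD D₊D

      σ-X⊛ : ∀ f → σ (X ⊛ f) ≗ (neg X ⊛ σ f)
      σ-X⊛ f = ≗-trans (σ-⊛ X f) (⊛-cong {g = σ f} σ-X ≗-refl)

      σ-C⊛ : ∀ c f → σ (C c ⊛ f) ≗ (C c ⊛ σ f)
      σ-C⊛ c f = ≗-trans (σ-⊛ (C c) f) (⊛-cong {g = σ f} (σ-C c) ≗-refl)

      σσ : ∀ f g → σ (σ f ⊛ σ g) ≗ (f ⊛ g)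
      σσ f g = ≗-trans (σ-⊛ (σ f) (σ g)) (⊛-cong (σ-involutive f) (σ-involutive g))

      -- The series is even: x ↦ -x exchanges its two summands.
      σ-swap : ∀ f g → σ (f ⊛ g ⊕ σ f ⊛ σ g) ≗ (f ⊛ g ⊕ σ f ⊛ σ g)
      σ-swap f g = ≗-trans (σ-⊕ (f ⊛ g) (σ f ⊛ σ g)) (≗-trans (⊕-cong (σ-⊛ f g) (σσ f g))
        (CommutativeRing.+-comm seriesRing (σ f ⊛ σ g) (f ⊛ g)))

      σD-eq : σ D ≗ (C 1ℚ ⊕ neg X ⊛ (C ½ ⊛ D²))
      σD-eq = ≗-trans (σ-cong (proj₁ eqs)) (≗-trans (σ-⊕ (C 1ℚ) (X ⊛ (C ½ ⊛ D²)))
        (⊕-cong (σ-C 1ℚ) (≗-trans (σ-X⊛ (C ½ ⊛ D²)) (⊛-cong {neg X} ≗-refl (≗-trans (σ-C⊛ ½ D²) (⊛-cong {C ½} ≗-refl (σ-swap D D)))))))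

      σ-⊖ : ∀ f g → σ (f ⊖ g) ≗ (σ f ⊖ σ g)
      σ-⊖ f g n = solveℚ 3 (λ a b c → a ⊠ (b ⊟ c) ≔ a ⊠ b ⊟ a ⊠ c) refl (alt n) (f n) (g n)

      σW : σ (C (- ½) ⊛ (D² ⊖ C (q 2) ⊛ σ D)) ≗ (C (- ½) ⊛ (D² ⊖ C (q 2) ⊛ D))
      σW = ≗-trans (σ-C⊛ (- ½) _) (⊛-cong {C (- ½)} ≗-refl (≗-trans (σ-⊖ D² (C (q 2) ⊛ σ D))
        (⊕-cong (σ-swap D D) (neg-cong (≗-trans (σ-C⊛ (q 2) (σ D)) (⊛-cong {C (q 2)} ≗-refl (σ-involutive D)))))))

      σXX : ∀ W → σ (X ⊛ (X ⊛ W)) ≗ (X ⊛ (X ⊛ σ W))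
      σXX W = ≗-trans (σ-X⊛ (X ⊛ W)) (≗-trans (⊛-cong {neg X} ≗-refl (σ-X⊛ W))
        (solve 2 (λ X W → (:- X) :* ((:- X) :* W) := X :* (X :* W)) ≗-refl X (σ W)))

      σG-eq : σ G ≗ (neg X ⊛ (G ⊛ D ⊕ σ G ⊛ σ D) ⊕ X ⊛ (X ⊛ (C (- ½) ⊛ (D² ⊖ C (q 2) ⊛ D))))
      σG-eq = ≗-trans (σ-cong (proj₂ eqs)) (≗-trans (σ-⊕ (X ⊛ (G ⊛ D ⊕ σ G ⊛ σ D)) _)
        (⊕-cong (≗-trans (σ-X⊛ (G ⊛ D ⊕ σ G ⊛ σ D)) (⊛-cong {neg X} ≗-refl (σ-swap G D)))
                (≗-trans (σXX _) (⊛-cong {X} ≗-refl (⊛-cong {X} ≗-refl σW)))))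

    signed-closed : G ≗ (((- ½) · poly (1ℚ ∷ - q 3 ∷ - q 2 ∷ [])) ⊕ (½ · (poly (1ℚ ∷ - q 3 ∷ - q 4 ∷ q 4 ∷ []) ⊛ T)))
    signed-closed = SignedClosedForm.G-closed D (σ D) G (σ G) T (proj₁ eqs) σD-eq (proj₂ eqs) σG-eq T-inv

open Patterns
open PowerSeries
open import Data.Bool using (Bool; true; false; if_then_else_)
import Data.Bool.Properties as Boolₚ
open import Data.Empty using (⊥-elim)
import Data.Integer as ℤ
import Data.Integer.Properties as ℤₚ
open import Data.List using (map; filter; length; _++_; upTo; concatMap; cartesianProduct)
open import Data.List.Membership.Propositional using (_∈_; lose; find)
open import Data.List.Membership.Propositional.Properties
open import Data.List.Membership.Propositional.Properties.WithK using (unique∧set⇒bag)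
open import Data.List.Relation.Binary.BagAndSetEquality using (∼bag⇒↭)
open import Data.List.Relation.Binary.Permutation.Propositional as Perm using (_↭_)
open import Data.List.Relation.Unary.All as All using ([]; _∷_)
open import Data.List.Relation.Unary.AllPairs using ([]; _∷_)
open import Data.List.Relation.Unary.Any using (here; there)
open import Data.List.Relation.Unary.Unique.Propositional using (Unique)
import Data.List.Relation.Unary.Unique.Propositional.Properties as Uniqueₚ
import Data.Nat.Coprimality as Coprime
open import Data.Nat.Coprimality using (1-coprimeTo)
open import Data.Nat as ℕ using (ℕ; zero; suc; pred; _∸_; _≤_; _<_; z≤n; s≤s; s≤s⁻¹)
import Data.Nat.Properties as ℕₚ
open import Data.Product using (_,_; proj₁; proj₂; uncurry)
open import Data.Rational using (mkℚ; _+_; _*_)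
import Data.Rational.Properties as ℚₚ
open import Data.Rational.Solver using (module +-*-Solver)
open import Data.Sum using (inj₁; inj₂)
open import Function using (_∘_)
open import Function.Bundles using (mk⇔)
open import Relation.Binary.PropositionalEquality
  using (_≢_; refl; sym; trans; cong; cong₂; subst; module ≡-Reasoning)
open import Relation.Nullary using (¬_; yes; no)
open import Relation.Nullary.Decidable using (_×-dec_)
open import Relation.Unary using (Pred; Decidable)
open +-*-Solver using (solve; _:=_; _:+_; _:*_; _:-_; :-_; con)

-- Finite sums over lists.

private variable
  A B : Set

Σ-cong-∈ : ∀ {f g : A → ℚ} xs → (∀ {x} → x ∈ xs → f x ≡ g x) → Σ f xs ≡ Σ g xs
Σ-cong-∈ []       p = refl
Σ-cong-∈ (x ∷ xs) p = cong₂ _+_ (p (here refl)) (Σ-cong-∈ xs (p ∘ there))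

Σ-zero : ∀ {f : A → ℚ} xs → (∀ {x} → x ∈ xs → f x ≡ 0ℚ) → Σ f xs ≡ 0ℚ
Σ-zero []       p = refl
Σ-zero (x ∷ xs) p = cong₂ _+_ (p (here refl)) (Σ-zero xs (p ∘ there))

Σ-++ : ∀ (f : A → ℚ) xs ys → Σ f (xs ++ ys) ≡ Σ f xs + Σ f ys
Σ-++ f []       ys = sym (ℚₚ.+-identityˡ (Σ f ys))
Σ-++ f (x ∷ xs) ys = trans (cong (_+_ (f x)) (Σ-++ f xs ys)) (sym (ℚₚ.+-assoc (f x) (Σ f xs) (Σ f ys)))

Σ-map : ∀ (f : B → ℚ) (g : A → B) xs → Σ f (map g xs) ≡ Σ (f ∘ g) xs
Σ-map f g []       = refl
Σ-map f g (x ∷ xs) = cong (_+_ (f (g x))) (Σ-map f g xs)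

Σ-concatMap : ∀ (f : B → ℚ) (g : A → List B) xs → Σ f (concatMap g xs) ≡ Σ (λ x → Σ f (g x)) xs
Σ-concatMap f g []       = refl
Σ-concatMap f g (x ∷ xs) = trans (Σ-++ f (g x) (concatMap g xs)) (cong (_+_ (Σ f (g x))) (Σ-concatMap f g xs))

Σ-cartesianProduct : ∀ (f : A → ℚ) (g : B → ℚ) xs ys →
                     Σ (λ (x , y) → f x * g y) (cartesianProduct xs ys) ≡ Σ f xs * Σ g ys
Σ-cartesianProduct f g []       ys = sym (ℚₚ.*-zeroˡ (Σ g ys))
Σ-cartesianProduct f g (x ∷ xs) ys = begin
  Σ (λ (x , y) → f x * g y) (map (x ,_) ys ++ cartesianProduct xs ys)
    ≡⟨ Σ-++ _ (map (x ,_) ys) (cartesianProduct xs ys) ⟩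
  Σ (λ (x , y) → f x * g y) (map (x ,_) ys) + Σ (λ (x , y) → f x * g y) (cartesianProduct xs ys)
    ≡⟨ cong₂ _+_ (trans (Σ-map _ (x ,_) ys) (Σ-* (f x) g ys)) (Σ-cartesianProduct f g xs ys) ⟩
  f x * Σ g ys + Σ f xs * Σ g ys
    ≡⟨ ℚₚ.*-distribʳ-+ (Σ g ys) (f x) (Σ f xs) ⟨
  (f x + Σ f xs) * Σ g ys ∎
  where open ≡-Reasoning

Σ-↭ : ∀ (f : A → ℚ) {xs ys} → xs ↭ ys → Σ f xs ≡ Σ f ys
Σ-↭ f Perm.refl        = refl
Σ-↭ f (Perm.prep x p)  = cong (_+_ (f x)) (Σ-↭ f p)
Σ-↭ f (Perm.swap {xs} {ys} x y p) = trans (cong (λ s → f x + (f y + s)) (Σ-↭ f p))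
  (solve 3 (λ a b s → a :+ (b :+ s) := b :+ (a :+ s)) refl (f x) (f y) (Σ f ys))
Σ-↭ f (Perm.trans p q) = trans (Σ-↭ f p) (Σ-↭ f q)

Σ-filter : ∀ {p} {P : Pred A p} (P? : Decidable P) (f : A → ℚ) xs → (∀ {x} → x ∈ xs → ¬ P x → f x ≡ 0ℚ) →
           Σ f (filter P? xs) ≡ Σ f xs
Σ-filter P? f []       z = refl
Σ-filter P? f (x ∷ xs) z with P? x
... | yes _ = cong (_+_ (f x)) (Σ-filter P? f xs (z ∘ there))
... | no ¬p = trans (Σ-filter P? f xs (z ∘ there))
  (sym (trans (cong (_+ Σ f xs) (z (here refl) ¬p)) (ℚₚ.+-identityˡ (Σ f xs))))

Unique-map : ∀ (f : A → B) {xs} → (∀ {x y} → x ∈ xs → y ∈ xs → f x ≡ f y → x ≡ y) → Unique xs → Unique (map f xs)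
Unique-map f {[]}     inj []         = []
Unique-map f {x ∷ xs} inj (x∉ ∷ xs!) = Unique-∷⁺ fresh (Unique-map f (λ x∈ y∈ → inj (there x∈) (there y∈)) xs!)
  where
  fresh : ∀ {y} → y ∈ map f xs → f x ≢ y
  fresh y∈ fx≡y with z , z∈ , refl ← ∈-map⁻ f y∈ = All.lookup x∉ z∈ (inj (here refl) (there z∈) fx≡y)

-- Enumerating the pieces by pairs of permutations.

Family : Set
Family = ℕ → List (List ℕ)

pairs : Family → Family → ℕ → List (List ℕ × List ℕ)
pairs F G n = concatMap (λ j → cartesianProduct (F j) (G (n ∸ j))) (upTo (suc n))

-- Lets the indices of a pair be read off from its words, so that the blocks of `pairs` are disjoint
-- and weights can be written through lengths.
Graded : Family → Set
Graded F = ∀ {n w} → w ∈ F n → length w ≡ n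

module _ {F G : Family} (gradedF : Graded F) (gradedG : Graded G) where

  ∈-pairs⁻ : ∀ {n u w} → (u , w) ∈ pairs F G n → u ∈ F (length u) × w ∈ G (length w) × length u ℕ.+ length w ≡ n
  ∈-pairs⁻ {n} {w = w} p∈ with j , j∈ , uw∈ ← find (∈-concatMap⁻ (λ j → cartesianProduct (F j) (G (n ∸ j))) {xs = upTo (suc n)} p∈)
    with u∈ , w∈ ← ∈-cartesianProduct⁻ (F j) (G (n ∸ j)) uw∈
    with refl ← gradedF u∈ = u∈ , subst (λ k → w ∈ G k) (sym (gradedG w∈)) w∈ ,
      trans (cong (j ℕ.+_) (gradedG w∈)) (ℕₚ.m+[n∸m]≡n (s≤s⁻¹ (∈-upTo⁻ j∈)))

  ∈-pairs⁺ : ∀ {u w} → u ∈ F (length u) → w ∈ G (length w) → (u , w) ∈ pairs F G (length u ℕ.+ length w)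
  ∈-pairs⁺ {u} {w} u∈ w∈ = ∈-concatMap⁺ _ (lose (∈-upTo⁺ (s≤s (ℕₚ.m≤m+n (length u) (length w))))
    (∈-cartesianProduct⁺ u∈ (subst (λ k → w ∈ G k) (sym (ℕₚ.m+n∸m≡n (length u) (length w))) w∈)))

  pairs-Unique : (∀ n → Unique (F n)) → (∀ n → Unique (G n)) → ∀ n → Unique (pairs F G n)
  pairs-Unique F! G! n = concatMap-Unique (length ∘ proj₁) (λ j → cartesianProduct (F j) (G (n ∸ j)))
    (λ j → Uniqueₚ.cartesianProduct⁺ (F! j) (G! (n ∸ j)))
    (λ {j} p∈ → gradedF (proj₁ (∈-cartesianProduct⁻ (F j) (G (n ∸ j)) p∈))) (Uniqueₚ.upTo⁺ (suc n))

  Σ-pairs : ∀ κ (f g : List ℕ → ℚ) n →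
            Σ (λ (u , w) → κ (length u) (length w) * (f u * g w)) (pairs F G n)
              ≡ conv κ (λ k → Σ f (F k)) (λ k → Σ g (G k)) n
  Σ-pairs κ f g n = trans (Σ-concatMap h (λ j → cartesianProduct (F j) (G (n ∸ j))) (upTo (suc n))) (Σ-cong (λ j → trans
    (Σ-cong-∈ {f = h} {λ (u , w) → κ j (n ∸ j) * (f u * g w)} (cartesianProduct (F j) (G (n ∸ j)))
      (λ {(u , w)} p∈ → let u∈ , w∈ = ∈-cartesianProduct⁻ (F j) (G (n ∸ j)) p∈ in
        cong₂ (λ j k → κ j k * (f u * g w)) (gradedF u∈) (gradedG w∈)))
    (trans (Σ-* (κ j (n ∸ j)) (λ (u , w) → f u * g w) (cartesianProduct (F j) (G (n ∸ j))))
      (cong (κ j (n ∸ j) *_) (Σ-cartesianProduct f g (F j) (G (n ∸ j)))))) (upTo (suc n)))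
    where
    h : List ℕ × List ℕ → ℚ
    h (u , w) = κ (length u) (length w) * (f u * g w)

perms-graded : Graded perms
perms-graded w∈ = IsPerm.length≡ (∈-perms⁻ w∈)

nonemptyPerms : Family
nonemptyPerms zero    = []
nonemptyPerms (suc n) = perms (suc n)

nonemptyPerms-graded : Graded nonemptyPerms
nonemptyPerms-graded {suc n} = perms-graded

nonemptyPerms-Unique : ∀ n → Unique (nonemptyPerms n)
nonemptyPerms-Unique zero    = []
nonemptyPerms-Unique (suc n) = perms-Unique (suc n)

-- The right part comes first, as its length takes the place of `j` in the sign with exponent
-- `suc j * k`. The index drops by one because the entry just before the maximum belongs to neither
-- part.
crossedPairs : ℕ → List (List ℕ × List ℕ)
crossedPairs zero    = []
crossedPairs (suc n) = pairs nonemptyPerms perms n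

pieces : ℕ → List Piece
pieces n = map (uncurry uncrossed) (pairs perms perms n) ++ map (λ (r , l) → crossed l r) (crossedPairs n)

∈-uncrossed⁻ : ∀ {n p} → p ∈ pairs perms perms n → Valid n (uncurry uncrossed p)
∈-uncrossed⁻ {n} p∈ with l∈ , r∈ , eq ← ∈-pairs⁻ {perms} {perms} perms-graded perms-graded {n} p∈ =
  uncrossed (∈-perms⁻ l∈) (∈-perms⁻ r∈) eq

∈-crossed⁻ : ∀ {n r l} → (r , l) ∈ crossedPairs n → Valid n (crossed l r)
∈-crossed⁻ {suc n} {r} {l} p∈ with ∈-pairs⁻ {nonemptyPerms} {perms} (λ {n} → nonemptyPerms-graded {n}) perms-graded {n} p∈
∈-crossed⁻ {suc n} {a ∷ r} {l} p∈ | r∈ , l∈ , eq =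
  crossed (∈-perms⁻ l∈) (∈-perms⁻ r∈) (cong suc (trans (ℕₚ.+-comm (length l) (suc (length r))) eq))

∈-pieces⁻ : ∀ {n p} → p ∈ pieces n → Valid n p
∈-pieces⁻ {n} p∈ with ∈-++⁻ (map (uncurry uncrossed) (pairs perms perms n)) p∈
... | inj₁ p∈ with _ , q∈ , refl ← ∈-map⁻ _ p∈ = ∈-uncrossed⁻ q∈
... | inj₂ p∈ with _ , q∈ , refl ← ∈-map⁻ _ p∈ = ∈-crossed⁻ q∈

∈-pieces⁺ : ∀ {n p} → Valid n p → p ∈ pieces n
∈-pieces⁺ (uncrossed pl pr refl) =
  ∈-++⁺ˡ (∈-map⁺ _ (∈-pairs⁺ {perms} {perms} perms-graded perms-graded (∈-perms⁺ pl) (∈-perms⁺ pr)))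
∈-pieces⁺ {n} (crossed {l} {a} {r} pl pr refl) =
  ∈-++⁺ʳ (map (uncurry uncrossed) (pairs perms perms n)) (∈-map⁺ (λ (r , l) → crossed l r)
    (subst (λ m → (a ∷ r , l) ∈ pairs nonemptyPerms perms m) (ℕₚ.+-comm (suc (length r)) (length l))
      (∈-pairs⁺ {nonemptyPerms} {perms} (λ {n} → nonemptyPerms-graded {n}) perms-graded (∈-perms⁺ pr) (∈-perms⁺ pl))))

pieces-Unique : ∀ n → Unique (pieces n)
pieces-Unique n = Unique-++⁺
  (Uniqueₚ.map⁺ (λ { refl → refl }) (pairs-Unique {perms} {perms} perms-graded perms-graded perms-Unique perms-Unique n))
  (Uniqueₚ.map⁺ (λ { refl → refl }) (crossedPairs-Unique n))
  disjoint
  where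
  crossedPairs-Unique : ∀ n → Unique (crossedPairs n)
  crossedPairs-Unique zero    = []
  crossedPairs-Unique (suc n) = pairs-Unique {nonemptyPerms} {perms} (λ {n} → nonemptyPerms-graded {n}) perms-graded nonemptyPerms-Unique perms-Unique n
  disjoint : ∀ {p p′} → p ∈ map (uncurry uncrossed) (pairs perms perms n) →
             p′ ∈ map (λ (r , l) → crossed l r) (crossedPairs n) → p ≢ p′
  disjoint p∈ p′∈ refl with _ , _ , refl ← ∈-map⁻ _ p∈ with _ , _ , () ← ∈-map⁻ _ p′∈

few? : Decidable (λ w → occ132 w ≤ 1)
few? w = occ132 w ℕₚ.≤? 1

-- Two lists without repetition and with the same members agree up to order. Both sides are
-- filtered: `decompose` covers at most one occurrence, whereas a piece may assemble to a
-- permutation with more.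
perms↭pieces : ∀ n → filter few? (perms (suc n)) ↭ map assemble (filter (few? ∘ assemble) (pieces n))
perms↭pieces n = ∼bag⇒↭ (unique∧set⇒bag (Uniqueₚ.filter⁺ few? (perms-Unique (suc n)))
  (Unique-map assemble (λ p∈ p′∈ → assemble-injective (valid p∈) (valid p′∈)) (Uniqueₚ.filter⁺ (few? ∘ assemble) (pieces-Unique n)))
  (λ {w} → mk⇔ (to {w}) (from {w})))
  where
  valid : ∀ {p} → p ∈ filter (few? ∘ assemble) (pieces n) → Valid n p
  valid p∈ = ∈-pieces⁻ (proj₁ (∈-filter⁻ (few? ∘ assemble) {xs = pieces n} p∈))
  to : ∀ {w} → w ∈ filter few? (perms (suc n)) → w ∈ map assemble (filter (few? ∘ assemble) (pieces n))
  to w∈ with w∈perms , few ← ∈-filter⁻ few? {xs = perms (suc n)} w∈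
    with p , v , refl ← decompose {n} (∈-perms⁻ {suc n} w∈perms) few =
    ∈-map⁺ assemble (∈-filter⁺ (few? ∘ assemble) (∈-pieces⁺ v) few)
  from : ∀ {w} → w ∈ map assemble (filter (few? ∘ assemble) (pieces n)) → w ∈ filter few? (perms (suc n))
  from w∈ with p , p∈ , refl ← ∈-map⁻ assemble w∈ =
    ∈-filter⁺ few? (∈-perms⁺ (assemble-IsPerm (valid p∈))) (proj₂ (∈-filter⁻ (few? ∘ assemble) {xs = pieces n} p∈))

Σ-perms-suc : ∀ f n → (∀ w → ¬ occ132 w ≤ 1 → f w ≡ 0ℚ) →
              Σ f (perms (suc n)) ≡ Σ (λ (l , r) → f (assemble (uncrossed l r))) (pairs perms perms n)
                                    + Σ (λ (r , l) → f (assemble (crossed l r))) (crossedPairs n)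
Σ-perms-suc f n vanish = begin
  Σ f (perms (suc n))                                              ≡⟨ Σ-filter few? f (perms (suc n)) (λ {w} _ → vanish w) ⟨
  Σ f (filter few? (perms (suc n)))                                ≡⟨ Σ-↭ f (perms↭pieces n) ⟩
  Σ f (map assemble (filter (few? ∘ assemble) (pieces n)))         ≡⟨ Σ-map f assemble (filter (few? ∘ assemble) (pieces n)) ⟩
  Σ (f ∘ assemble) (filter (few? ∘ assemble) (pieces n))
    ≡⟨ Σ-filter (few? ∘ assemble) (f ∘ assemble) (pieces n) (λ {p} _ → vanish (assemble p)) ⟩
  Σ (f ∘ assemble) (pieces n)
    ≡⟨ Σ-++ (f ∘ assemble) (map (uncurry uncrossed) (pairs perms perms n)) (map (λ (r , l) → crossed l r) (crossedPairs n)) ⟩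
  Σ (f ∘ assemble) (map (uncurry uncrossed) (pairs perms perms n)) + Σ (f ∘ assemble) (map (λ (r , l) → crossed l r) (crossedPairs n))
    ≡⟨ cong₂ _+_ (Σ-map (f ∘ assemble) _ (pairs perms perms n)) (Σ-map (f ∘ assemble) _ (crossedPairs n)) ⟩
  Σ (λ (l , r) → f (assemble (uncrossed l r))) (pairs perms perms n) + Σ (λ (r , l) → f (assemble (crossed l r))) (crossedPairs n) ∎
  where open ≡-Reasoning

-- Weights and the recurrences that they satisfy.

δ : ℕ → ℕ → ℚ
δ zero    zero    = 1ℚ
δ zero    (suc n) = 0ℚ
δ (suc m) zero    = 0ℚ
δ (suc m) (suc n) = δ m n

δ₀-+ : ∀ a b → δ 0 (a ℕ.+ b) ≡ δ 0 a * δ 0 b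
δ₀-+ zero    b = sym (ℚₚ.*-identityˡ (δ 0 b))
δ₀-+ (suc a) b = sym (ℚₚ.*-zeroˡ (δ 0 b))

δ₁-+ : ∀ a b → δ 1 (a ℕ.+ b) ≡ δ 1 a * δ 0 b + δ 0 a * δ 1 b
δ₁-+ zero    b = solve 2 (λ x y → y := con 0ℚ :* x :+ con 1ℚ :* y) refl (δ 0 b) (δ 1 b)
δ₁-+ (suc a) b = trans (δ₀-+ a b) (solve 3 (λ x y z → x :* y := x :* y :+ con 0ℚ :* z) refl (δ 0 a) (δ 0 b) (δ 1 b))

δ-large : ∀ t {a} → t < a → δ t a ≡ 0ℚ
δ-large zero    {suc a} _   = refl
δ-large (suc t) {suc a} t<a = δ-large t (s≤s⁻¹ t<a)

-- By multiplicativity, `χ` of the inversions of a piece is the product of its values on the two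
-- parts and at the number of inversions contributed by the assembly, which is a function of the
-- lengths.
module Weighted (χ : ℕ → ℚ) (χ-zero : χ 0 ≡ 1ℚ) (χ-+ : ∀ a b → χ (a ℕ.+ b) ≡ χ a * χ b) where

  weight : ℕ → List ℕ → ℚ
  weight t w = δ t (occ132 w) * χ (inv w)

  total : ℕ → Series
  total t n = Σ (weight t) (perms n)

  private
    κ : ℕ → ℕ → ℚ
    κ j k = χ (suc j ℕ.* k)

    κˣ : ℕ → ℕ → ℚ
    κˣ k i = χ (i ℕ.* suc k ℕ.+ (pred k ℕ.+ k))

    crossed-total : Series
    crossed-total n = Σ (λ (r , l) → weight 1 (assemble (crossed l r))) (crossedPairs n)

    weight-large : ∀ {t} → t ≤ 1 → ∀ w → ¬ occ132 w ≤ 1 → weight t w ≡ 0ℚ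
    weight-large {t} t≤1 w many = trans (cong (_* χ (inv w)) (δ-large t (ℕₚ.≤-<-trans t≤1 (ℕₚ.≰⇒> many)))) (ℚₚ.*-zeroˡ (χ (inv w)))

    χ-+₃ : ∀ a b c → χ (a ℕ.+ b ℕ.+ c) ≡ χ c * (χ a * χ b)
    χ-+₃ a b c = trans (χ-+ (a ℕ.+ b) c) (trans (cong (_* χ c) (χ-+ a b)) (ℚₚ.*-comm (χ a * χ b) (χ c)))

    uncrossed-weight : ∀ t {n l r} → Valid n (uncrossed l r) →
      weight t (assemble (uncrossed l r)) ≡ δ t (occ132 l ℕ.+ occ132 r) * (κ (length l) (length r) * (χ (inv l) * χ (inv r)))
    uncrossed-weight t {l = l} {r} (uncrossed pl pr _) = cong₂ (λ o i → δ t o * i) (occ132-uncrossed pl pr)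
      (trans (cong χ (inv-uncrossed pl pr)) (χ-+₃ (inv l) (inv r) (suc (length l) ℕ.* length r)))

    crossed-weight : ∀ t {n l r} → Valid n (crossed l r) →
      weight t (assemble (crossed l r)) ≡ δ t (suc (occ132 l ℕ.+ occ132 r)) * (κˣ (length r) (length l) * (χ (inv l) * χ (inv r)))
    crossed-weight t {l = l} {r} (crossed pl pr _) = cong₂ (λ o i → δ t o * i) (occ132-crossed pl refl pr)
      (trans (cong χ (inv-crossed pl refl pr)) (χ-+₃ (inv l) (inv r) (length l ℕ.* suc (length r) ℕ.+ (pred (length r) ℕ.+ length r))))

    Σ-perm-pairs : ∀ κ f g n → Σ (λ (u , w) → κ (length u) (length w) * (f u * g w)) (pairs perms perms n)
                     ≡ conv κ (λ k → Σ f (perms k)) (λ k → Σ g (perms k)) n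
    Σ-perm-pairs = Σ-pairs {perms} {perms} perms-graded perms-graded

    uncrossed-total₀ : ∀ n → Σ (λ (l , r) → weight 0 (assemble (uncrossed l r))) (pairs perms perms n) ≡ conv κ (total 0) (total 0) n
    uncrossed-total₀ n = trans
      (Σ-cong-∈ (pairs perms perms n) (λ {(l , r)} p∈ → trans (uncrossed-weight 0 {n} (∈-uncrossed⁻ p∈))
        (trans (cong (_* (κ (length l) (length r) * (χ (inv l) * χ (inv r)))) (δ₀-+ (occ132 l) (occ132 r)))
          (solve 5 (λ a b k x y → (a :* b) :* (k :* (x :* y)) := k :* ((a :* x) :* (b :* y))) refl
            (δ 0 (occ132 l)) (δ 0 (occ132 r)) (κ (length l) (length r)) (χ (inv l)) (χ (inv r))))))
      (Σ-perm-pairs κ (weight 0) (weight 0) n)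

    uncrossed-total₁ : ∀ n → Σ (λ (l , r) → weight 1 (assemble (uncrossed l r))) (pairs perms perms n)
                       ≡ conv κ (total 1) (total 0) n + conv κ (total 0) (total 1) n
    uncrossed-total₁ n = trans
      (Σ-cong-∈ (pairs perms perms n) (λ {(l , r)} p∈ → trans (uncrossed-weight 1 {n} (∈-uncrossed⁻ p∈))
        (trans (cong (_* (κ (length l) (length r) * (χ (inv l) * χ (inv r)))) (δ₁-+ (occ132 l) (occ132 r)))
          (solve 7 (λ a b c d k x y → (a :* b :+ c :* d) :* (k :* (x :* y))
              := k :* ((a :* x) :* (b :* y)) :+ k :* ((c :* x) :* (d :* y))) refl
            (δ 1 (occ132 l)) (δ 0 (occ132 r)) (δ 0 (occ132 l)) (δ 1 (occ132 r)) (κ (length l) (length r)) (χ (inv l)) (χ (inv r))))))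
      (trans (Σ-+ (λ (l , r) → κ (length l) (length r) * (weight 1 l * weight 0 r))
                  (λ (l , r) → κ (length l) (length r) * (weight 0 l * weight 1 r)) (pairs perms perms n))
        (cong₂ _+_ (Σ-perm-pairs κ (weight 1) (weight 0) n) (Σ-perm-pairs κ (weight 0) (weight 1) n)))

    crossed-total₀ : ∀ n → Σ (λ (r , l) → weight 0 (assemble (crossed l r))) (crossedPairs n) ≡ 0ℚ
    crossed-total₀ n = Σ-zero (crossedPairs n) (λ {(r , l)} p∈ →
      trans (crossed-weight 0 {n} (∈-crossed⁻ p∈)) (ℚₚ.*-zeroˡ (κˣ (length r) (length l) * (χ (inv l) * χ (inv r)))))

    total-zero : total 0 0 ≡ 1ℚ
    total-zero = trans (ℚₚ.+-identityʳ _) (trans (ℚₚ.*-identityˡ (χ 0)) χ-zero)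

    Σ-nonempty : ∀ k → Σ (weight 0) (nonemptyPerms k) ≡ (total 0 ⊖ C 1ℚ) k
    Σ-nonempty zero    = sym (cong (_+ - 1ℚ) total-zero)
    Σ-nonempty (suc k) = sym (ℚₚ.+-identityʳ (total 0 (suc k)))

    crossed-total-suc : ∀ n → crossed-total (suc n) ≡ conv κˣ (total 0 ⊖ C 1ℚ) (total 0) n
    crossed-total-suc n = trans
      (Σ-cong-∈ (crossedPairs (suc n)) (λ {(r , l)} p∈ → trans (crossed-weight 1 {suc n} (∈-crossed⁻ p∈))
        (trans (cong (_* (κˣ (length r) (length l) * (χ (inv l) * χ (inv r)))) (δ₀-+ (occ132 l) (occ132 r)))
          (solve 5 (λ a b k x y → (a :* b) :* (k :* (x :* y)) := k :* ((b :* y) :* (a :* x))) refl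
            (δ 0 (occ132 l)) (δ 0 (occ132 r)) (κˣ (length r) (length l)) (χ (inv l)) (χ (inv r))))))
      (trans (Σ-pairs {nonemptyPerms} {perms} (λ {n} → nonemptyPerms-graded {n}) perms-graded κˣ (weight 0) (weight 0) n)
        (conv-cong {κˣ} {λ k → Σ (weight 0) (nonemptyPerms k)} {total 0} {κˣ} {total 0 ⊖ C 1ℚ} {total 0}
          (λ j k → cong (λ z → κˣ j k * (z * total 0 k)) (Σ-nonempty j)) n))

  recurrence : Recurrence χ (total 0) (total 1)
  recurrence = record
    { crossed      = crossed-total
    ; A-zero       = total-zero
    ; A-suc        = λ n → trans (Σ-perms-suc (weight 0) n (weight-large z≤n))
                       (trans (cong₂ _+_ (uncrossed-total₀ n) (crossed-total₀ n)) (ℚₚ.+-identityʳ _))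
    ; B-zero       = trans (ℚₚ.+-identityʳ _) (ℚₚ.*-zeroˡ (χ 0))
    ; B-suc        = λ n → trans (Σ-perms-suc (weight 1) n (weight-large (s≤s z≤n))) (cong (_+ crossed-total n) (uncrossed-total₁ n))
    ; crossed-zero = refl
    ; crossed-suc  = crossed-total-suc }

module Plain  = Weighted (λ _ → 1ℚ) refl (λ _ _ → refl)
module Signed = Weighted alt refl alt-+

-- From counts to weighted sums, and the final linear combination.

suc-/1 : ∀ n → + suc n / 1 ≡ 1ℚ + + n / 1
suc-/1 n = begin
  + suc n / 1                                 ≡⟨ ℚₚ./-cong (cong (ℤ._+_ (+ 1)) (ℤₚ.*-identityʳ (+ n))) refl ⟨
  -- With the fraction displayed as an explicit `mkℚ` of denominator 1, its sum with `1ℚ` unfolds to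
  -- this quotient.
  (+ 1 ℤ.+ + n ℤ.* + 1) / 1                   ≡⟨⟩
  1ℚ + mkℚ (+ n) 0 (Coprime.sym (1-coprimeTo n))   ≡⟨ cong (_+_ 1ℚ) (ℚₚ.normalize-coprime (Coprime.sym (1-coprimeTo n))) ⟨
  1ℚ + + n / 1                                ∎
  where open ≡-Reasoning

length-filter-as-Σ : ∀ {p} {P : Pred A p} (P? : Decidable P) (f : A → ℚ) →
                  (∀ {x} → P x → f x ≡ 1ℚ) → (∀ {x} → ¬ P x → f x ≡ 0ℚ) →
                  ∀ xs → + length (filter P? xs) / 1 ≡ Σ f xs
length-filter-as-Σ P? f f-in f-out []       = refl
length-filter-as-Σ P? f f-in f-out (x ∷ xs) with P? x
... | yes p = trans (suc-/1 (length (filter P? xs))) (cong₂ _+_ (sym (f-in p)) (length-filter-as-Σ P? f f-in f-out xs))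
... | no ¬p = trans (length-filter-as-Σ P? f f-in f-out xs) (sym (trans (cong (_+ Σ f xs) (f-out ¬p)) (ℚₚ.+-identityˡ (Σ f xs))))

δ-≡ : ∀ t → δ t t ≡ 1ℚ
δ-≡ zero    = refl
δ-≡ (suc t) = δ-≡ t

δ-≢ : ∀ t a → a ≢ t → δ t a ≡ 0ℚ
δ-≢ zero    zero    a≢t = ⊥-elim (a≢t refl)
δ-≢ zero    (suc a) a≢t = refl
δ-≢ (suc t) zero    a≢t = refl
δ-≢ (suc t) (suc a) a≢t = δ-≢ t a (a≢t ∘ cong suc)

alt-isEven : ∀ n → alt n ≡ (if isEven n then 1ℚ else - 1ℚ)
alt-isEven zero          = refl
alt-isEven (suc zero)    = refl
alt-isEven (suc (suc n)) = trans (solve 1 (λ a → :- :- a := a) refl (alt n)) (alt-isEven n)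

f1-total : ∀ n → ofℕ f1 n ≡ Plain.total 1 n
f1-total n = length-filter-as-Σ _ (Plain.weight 1)
  (λ {π} occ≡1 → cong (λ o → δ 1 o * 1ℚ) occ≡1)
  (λ {π} occ≢1 → cong (_* 1ℚ) (δ-≢ 1 (occ132 π) occ≢1)) (perms n)

parity-indicator : Bool → ℚ
parity-indicator true  = 1ℚ
parity-indicator false = - 1ℚ

-- (1 ± (-1)^inv) / 2 is the indicator of even, respectively odd, permutations.
parity-total : ∀ b n → + length (filter (λ π → (occ132 π ℕₚ.≟ 1) ×-dec (isEven (inv π) Boolₚ.≟ b)) (perms n)) / 1
                       ≡ ½ * (Plain.total 1 n + parity-indicator b * Signed.total 1 n)
parity-total b n = trans
  (length-filter-as-Σ (λ π → (occ132 π ℕₚ.≟ 1) ×-dec (isEven (inv π) Boolₚ.≟ b)) h (λ {π} → inside {π}) (λ {π} → outside {π}) (perms n))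
  (trans (Σ-* ½ (λ π → Plain.weight 1 π + parity-indicator b * Signed.weight 1 π) (perms n)) (cong (½ *_)
    (trans (Σ-+ (Plain.weight 1) (λ π → parity-indicator b * Signed.weight 1 π) (perms n))
      (cong (_+_ (Plain.total 1 n)) (Σ-* (parity-indicator b) (Signed.weight 1) (perms n))))))
  where
  h : List ℕ → ℚ
  h π = ½ * (Plain.weight 1 π + parity-indicator b * Signed.weight 1 π)
  value : ∀ π → h π ≡ δ 1 (occ132 π) * (½ * (1ℚ + parity-indicator b * (if isEven (inv π) then 1ℚ else - 1ℚ)))
  value π = trans (cong (λ z → ½ * (Plain.weight 1 π + parity-indicator b * (δ 1 (occ132 π) * z))) (alt-isEven (inv π)))
    (solve 3 (λ d p z → con ½ :* (d :* con 1ℚ :+ p :* (d :* z)) := d :* (con ½ :* (con 1ℚ :+ p :* z))) refl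
      (δ 1 (occ132 π)) (parity-indicator b) (if isEven (inv π) then 1ℚ else - 1ℚ))
  same : ∀ b → ½ * (1ℚ + parity-indicator b * (if b then 1ℚ else - 1ℚ)) ≡ 1ℚ
  same true  = refl
  same false = refl
  different : ∀ b c → c ≢ b → ½ * (1ℚ + parity-indicator b * (if c then 1ℚ else - 1ℚ)) ≡ 0ℚ
  different true  true  c≢b = ⊥-elim (c≢b refl)
  different true  false c≢b = refl
  different false true  c≢b = refl
  different false false c≢b = ⊥-elim (c≢b refl)
  inside : ∀ {π} → occ132 π ≡ 1 × isEven (inv π) ≡ b → h π ≡ 1ℚ
  inside {π} (occ≡1 , refl) = trans (value π) (cong₂ _*_ (cong (δ 1) occ≡1) (same (isEven (inv π))))
  outside : ∀ {π} → ¬ (occ132 π ≡ 1 × isEven (inv π) ≡ b) → h π ≡ 0ℚ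
  outside {π} ¬P with occ132 π ℕₚ.≟ 1
  ... | yes occ≡1 = trans (value π) (trans (cong (δ 1 (occ132 π) *_) (different b (isEven (inv π)) (λ eq → ¬P (occ≡1 , eq))))
                      (ℚₚ.*-zeroʳ (δ 1 (occ132 π))))
  ... | no  occ≢1 = trans (value π) (trans (cong (_* (½ * (1ℚ + parity-indicator b * (if isEven (inv π) then 1ℚ else - 1ℚ))))
                      (δ-≢ 1 (occ132 π) occ≢1)) (ℚₚ.*-zeroˡ (½ * (1ℚ + parity-indicator b * (if isEven (inv π) then 1ℚ else - 1ℚ)))))

theorem5 : (S T : Series) → IsInvSqrt1-4x S → IsInvSqrt1-4x² T →
    (∀ n → ofℕ e1 n ≡ ((- ½) · poly (1ℚ ∷ - q 2 ∷ - 1ℚ ∷ [])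
    ⊕ ((+ 1 / 4) · (poly (1ℚ ∷ - q 3 ∷ []) ⊛ S)
    ⊕ (+ 1 / 4) · (poly (1ℚ ∷ - q 3 ∷ - q 4 ∷ q 4 ∷ []) ⊛ T))) n)
    × (∀ n → ofℕ o1 n ≡ ((- ½) · poly (0ℚ ∷ 1ℚ ∷ 1ℚ ∷ [])
    ⊕ ((+ 1 / 4) · (poly (1ℚ ∷ - q 3 ∷ []) ⊛ S)
    ⊖ (+ 1 / 4) · (poly (1ℚ ∷ - q 3 ∷ - q 4 ∷ q 4 ∷ []) ⊛ T))) n)
    × (∀ n → ofℕ f1 n ≡ (½ · poly (- 1ℚ ∷ 1ℚ ∷ [])
    ⊕ ½ · (poly (1ℚ ∷ - q 3 ∷ []) ⊛ S)) n)
theorem5 S T S-inv T-inv =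
  (λ n → trans (trans (parity-total true n) (cong₂ (λ f g → ½ * (f + 1ℚ * g)) (plain n) (signed n)))
    (trans (solve 4 (λ a b u v → con ½ :* ((con ½ :* a :+ con ½ :* u) :+ con 1ℚ :* (con (- ½) :* b :+ con ½ :* v))
                := con ½ :* (con ½ :* a :+ con (- ½) :* b) :+ (con (+ 1 / 4) :* u :+ con (+ 1 / 4) :* v)) refl
             (p n) (r n) (U n) (V n))
      (cong (_+ (+ 1 / 4 * U n + + 1 / 4 * V n)) (even-poly n)))) ,
  (λ n → trans (trans (parity-total false n) (cong₂ (λ f g → ½ * (f + - 1ℚ * g)) (plain n) (signed n)))
    (trans (solve 4 (λ a b u v → con ½ :* ((con ½ :* a :+ con ½ :* u) :+ con (- 1ℚ) :* (con (- ½) :* b :+ con ½ :* v))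
                := con ½ :* (con ½ :* a :+ con ½ :* b) :+ (con (+ 1 / 4) :* u :- con (+ 1 / 4) :* v)) refl
             (p n) (r n) (U n) (V n))
      (cong (_+ (+ 1 / 4 * U n + - (+ 1 / 4 * V n))) (odd-poly n)))) ,
  (λ n → trans (f1-total n) (plain n))
  where
  plain  = unsigned-closed Plain.recurrence {S} S-inv
  signed = signed-closed Signed.recurrence {T} T-inv
  p r U V : Series
  p = poly (- 1ℚ ∷ 1ℚ ∷ [])
  r = poly (1ℚ ∷ - q 3 ∷ - q 2 ∷ [])
  U = poly (1ℚ ∷ - q 3 ∷ []) ⊛ S
  V = poly (1ℚ ∷ - q 3 ∷ - q 4 ∷ q 4 ∷ []) ⊛ T
  -- Half the difference and half the sum of the polynomial parts ½(x - 1) and ½(1 - 3x - 2x²): they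
  -- come to -½(1 - 2x - x²) and -½(x + x²), and every coefficient from degree 3 on is zero.
  even-poly : ∀ n → ½ * (½ * p n + - ½ * r n) ≡ - ½ * poly (1ℚ ∷ - q 2 ∷ - 1ℚ ∷ []) n
  even-poly zero                = refl
  even-poly (suc zero)          = refl
  even-poly (suc (suc zero))    = refl
  even-poly (suc (suc (suc n))) = refl
  odd-poly : ∀ n → ½ * (½ * p n + ½ * r n) ≡ - ½ * poly (0ℚ ∷ 1ℚ ∷ 1ℚ ∷ []) n
  odd-poly zero                = refl
  odd-poly (suc zero)          = refl
  odd-poly (suc (suc zero))    = refl
  odd-poly (suc (suc (suc n))) = refl
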